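{- Let $\mathbb{F}_q$ be a finite field with $q\equiv 1\pmod 3$. There are exactly $(2q+4)/3$ isomorphism classes (over $\mathbb{F}_q$) of elliptic curves $E$ over $\mathbb{F}_q$ whose group $E(\mathbb{F}_q)[3]$ of rational $3$-torsion points is cyclic of order $3$. Let $b_0\in\mathbb{F}_q$ be a non-cube and $\rho\in\mathbb{F}_q$ a primitive cube root of unity. A family of representatives of these classes is given by the curves $$y^2+m_a\,xy+b_0^i\,y=x^3,\qquad i\in\{0,1,2\},\ a\in\mathbb{F}_q,\ a^3-27b_0^i \text{ not a cube in } \mathbb{F}_q,$$ where $m_a=\min\{a,\rho a,\rho^2a\}$ with respect to a fixed total order on $\mathbb{F}_q$ (so that $m_a$ is a chosen representative of $\{a,\rho a,\rho^2 a\}$).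
   Context: Here $0$ counts as a cube, so the condition that $a^3-27b_0^i$ is not a cube includes $a^3\ne 27b_0^i$, i.e. nonsingularity of the curve. -}

module Defs where

open import Algebra.Bundles using (CommutativeRing; RawMonoid; Semiring)
open import Algebra.Core using (Op₁; Op₂)
open import Algebra.Structures using (IsCommutativeRing)
import Algebra.Construct.NaturalChoice.Min as Min
import Algebra.Definitions.RawMonoid as RawMonoidDefs
import Algebra.Definitions.RawSemiring as RawSemiringDefs
open import Data.Fin.Base using (Fin; toℕ)
open import Data.Fin.Properties using (inj⇒≟)
open import Data.Nat.Base using (ℕ)
open import Data.Product.Base using (Σ; ∃-syntax; _×_; proj₁)
open import Data.Unit.Polymorphic.Base using (⊤)
open import Function.Base using (_on_)
open import Function.Bundles using (_↔_)
open import Function.Properties.Inverse using (↔⇒↣)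
open import Level using (Level; suc)
open import Relation.Binary.Bundles using (TotalOrder)
open import Relation.Binary.Core using (Rel)
open import Relation.Binary.Definitions using (DecidableEquality)
open import Relation.Binary.PropositionalEquality.Core using (_≡_; _≢_)
open import Relation.Binary.Structures using (IsTotalOrder)
open import Relation.Nullary.Decidable.Core using (yes; no)
open import Relation.Nullary.Negation.Core using (¬_)
open import Relation.Unary using (Pred)

record FiniteField (c : Level) : Set (suc c) where
  infixl 7 _*_
  infixl 6 _+_
  infix  8 -_ _⁻¹
  field
    Carrier           : Set c
    _+_ _*_           : Op₂ Carrier
    -_                : Op₁ Carrier
    0# 1#             : Carrier
    isCommutativeRing : IsCommutativeRing _≡_ _+_ _*_ -_ 0# 1#
    0≢1               : 0# ≢ 1#
    -- The value of 0# ⁻¹ is left unspecified.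
    _⁻¹               : Op₁ Carrier
    *-inverseʳ        : ∀ x → x ≢ 0# → x * x ⁻¹ ≡ 1#
    order             : ℕ
    enumeration       : Carrier ↔ Fin order

  commutativeRing : CommutativeRing c c
  commutativeRing = record { isCommutativeRing = isCommutativeRing }

  open CommutativeRing commutativeRing public using (_-_; semiring)

  open RawSemiringDefs (Semiring.rawSemiring semiring) public
    using (_^_) renaming (_×_ to _·_)

  infix 4 _≟_
  _≟_ : DecidableEquality Carrier
  _≟_ = inj⇒≟ (↔⇒↣ enumeration)

  IsCube : Pred Carrier c
  IsCube x = ∃[ y ] y ^ 3 ≡ x

  IsPrimitiveCubeRootOfUnity : Pred Carrier c
  IsPrimitiveCubeRootOfUnity ρ = ρ ^ 3 ≡ 1# × ρ ≢ 1#

module EllipticCurves {c : Level} (F : FiniteField c) where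
  open FiniteField F

  -- y² + a₁xy + a₃y = x³ + a₂x² + a₄x + a₆
  record WeierstrassCurve : Set c where
    constructor weierstrass
    field
      a₁ a₂ a₃ a₄ a₆ : Carrier

    b₂ b₄ b₆ b₈ Δ : Carrier
    b₂ = a₁ ^ 2 + 4 · a₂
    b₄ = 2 · a₄ + a₁ * a₃
    b₆ = a₃ ^ 2 + 4 · a₆
    b₈ = a₁ ^ 2 * a₆ + 4 · a₂ * a₆ - a₁ * a₃ * a₄ + a₂ * a₃ ^ 2 - a₄ ^ 2
    Δ  = 9 · b₂ * b₄ * b₆ - b₂ ^ 2 * b₈ - 8 · b₄ ^ 3 - 27 · b₆ ^ 2

  open WeierstrassCurve using (Δ)

  IsElliptic : Pred WeierstrassCurve c
  IsElliptic E = Δ E ≢ 0#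

  -- E ≅ E′ via the admissible change of variables
  -- x = u²x′ + r, y = u³y′ + su²x′ + t, defined over the ground field.
  infix 4 _≅_
  record _≅_ (E E′ : WeierstrassCurve) : Set c where
    open WeierstrassCurve E
    open WeierstrassCurve E′ using ()
      renaming (a₁ to a₁′; a₂ to a₂′; a₃ to a₃′; a₄ to a₄′; a₆ to a₆′)
    field
      u r s t : Carrier
      u≢0     : u ≢ 0#
      a₁-eq   : u * a₁′ ≡ a₁ + 2 · s
      a₂-eq   : u ^ 2 * a₂′ ≡ a₂ - s * a₁ + 3 · r - s ^ 2
      a₃-eq   : u ^ 3 * a₃′ ≡ a₃ + r * a₁ + 2 · t
      a₄-eq   : u ^ 4 * a₄′ ≡ a₄ - s * a₃ + 2 · r * a₂ - (t + r * s) * a₁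
                              + 3 · r ^ 2 - 2 · s * t
      a₆-eq   : u ^ 6 * a₆′ ≡ a₆ + r * a₄ + r ^ 2 * a₂ + r ^ 3
                              - t * a₃ - t ^ 2 - r * t * a₁

  -- Points of the affine plane together with the point at infinity.
  data Point : Set c where
    ∞      : Point
    affine : (x y : Carrier) → Point

  module _ (E : WeierstrassCurve) where
    open WeierstrassCurve E

    OnCurve : Pred Point c
    OnCurve ∞            = ⊤
    OnCurve (affine x y) =
      y ^ 2 + a₁ * x * y + a₃ * y ≡ x ^ 3 + a₂ * x ^ 2 + a₄ * x + a₆

    -- The third intersection point of the line of slope m through (x₁ , y₁)
    -- and a second point with abscissa x₂, reflected by (x , y) ↦ (x , -y-a₁x-a₃).
    chord : (m x₁ y₁ x₂ : Carrier) → Point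
    chord m x₁ y₁ x₂ = affine x₃ (- (m * (x₃ - x₁) + y₁) - a₁ * x₃ - a₃)
      where x₃ = m ^ 2 + a₁ * m - a₂ - x₁ - x₂

    -- The chord-tangent law, given on all pairs of points but meaningful only for
    -- points on the curve: equal abscissae then mean that the points are opposite
    -- or that they coincide.
    infixl 6 _⊕_
    _⊕_ : Op₂ Point
    ∞ ⊕ Q = Q
    P@(affine _ _) ⊕ ∞ = P
    affine x₁ y₁ ⊕ affine x₂ y₂ with x₁ ≟ x₂
    ... | no _ = chord ((y₂ - y₁) * (x₂ - x₁) ⁻¹) x₁ y₁ x₂
    ... | yes _ with y₁ + y₂ + a₁ * x₂ + a₃ ≟ 0#
    ...   | yes _ = ∞
    ...   | no _  = chord ((3 · x₁ ^ 2 + 2 · a₂ * x₁ + a₄ - a₁ * y₁)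
                           * (2 · y₁ + a₁ * x₁ + a₃) ⁻¹) x₁ y₁ x₂

    pointRawMonoid : RawMonoid c c
    pointRawMonoid = record { Carrier = Point ; _≈_ = _≡_ ; _∙_ = _⊕_ ; ε = ∞ }

    open RawMonoidDefs pointRawMonoid using () renaming (_×_ to _•_)

    -- E(F)[ n ]
    Torsion : ℕ → Pred Point c
    Torsion n P = OnCurve P × n • P ≡ ∞

    IsCyclicOfOrder : ℕ → Pred Point c → Set c
    IsCyclicOfOrder n G =
      (∃[ P ] G P × (∀ Q → G Q → ∃[ k ] Q ≡ k • P)) × (Σ Point G ↔ Fin n)

  HasCyclic3Torsion : Pred WeierstrassCurve c
  HasCyclic3Torsion E = IsElliptic E × IsCyclicOfOrder E 3 (Torsion E 3)

  CurveWithCyclic3Torsion : Set c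
  CurveWithCyclic3Torsion = Σ WeierstrassCurve HasCyclic3Torsion

  infix 4 _≅₃_
  _≅₃_ : Rel CurveWithCyclic3Torsion c
  _≅₃_ = _≅_ on proj₁

  module Family {ℓ} (b₀ ρ : Carrier)
                {_≤_ : Rel Carrier ℓ} (≤-isTotalOrder : IsTotalOrder _≡_ _≤_) where

    totalOrder : TotalOrder c c ℓ
    totalOrder = record { isTotalOrder = ≤-isTotalOrder }

    open Min totalOrder using (_⊓_)

    m : Carrier → Carrier
    m a = a ⊓ (ρ * a) ⊓ (ρ ^ 2 * a)

    Admissible : Fin 3 → Carrier → Set c
    Admissible i a = ¬ IsCube (a ^ 3 - 27 · b₀ ^ toℕ i)

    curve : Fin 3 → Carrier → WeierstrassCurve
    curve i a = weierstrass (m a) 0# (b₀ ^ toℕ i) 0# 0#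

{-# OPTIONS --safe #-}

-- Write E₃(a, b) for the curve y² + axy + by = x³. A rational point of order 3 is
-- a flex; moving it to the origin with tangent y = 0 brings the curve into the form
-- E₃(a, b). A further rational flex of E₃(a, b), other than the two points with x = 0,
-- makes a³ - 27b a cube, namely ((3b + ar)/r)³ for a flex with abscissa r, and
-- conversely, when there is a primitive cube root of unity, a cube root of a³ - 27b
-- gives such a flex. So the curves with cyclic 3-torsion are those isomorphic to some
-- E₃(a, b) with a³ - 27b not a cube. Isomorphisms between these preserve the set of
-- flexes, which leaves only the scalings (a, b) = (va′, v³b′).
-- Up to scaling b is one of 1, b₀, b₀², and then a is determined up to powers of ρ.
-- For the count scale instead to a = 1, which gives one class for each non-cube
-- w = 1 - 27b, or to a = 0, which gives the two classes b = b₀ and b = b₀².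
-- There are 2(q - 1)/3 non-cubes.

module Submission where

open import Defs
open import Algebra.Bundles using (CommutativeRing; Semiring)
import Algebra.Construct.NaturalChoice.Min as Min
import Algebra.Properties.CommutativeMonoid.Sum as Sum
import Algebra.Properties.Monoid.Mult as Mult
open import Axiom.UniquenessOfIdentityProofs.WithK using (uip)
open import Data.Bool.Base using (Bool; true; false)
open import Data.Fin.Base as Fin using (Fin; zero; suc; toℕ; punchOut)
open import Data.Fin.Patterns using (0F; 1F; 2F; 3F)
open import Data.Fin.Permutation using (Permutation; _⟨$⟩ʳ_; ↔⇒≡)
import Data.Fin.Properties as Fin
open import Data.Fin.Properties using (injective⇒≤; +↔⊎; *↔×; punchOut-injective)
import Data.Integer.Properties as ℤ
open import Data.List.Base as List using (List; []; _∷_; filter; foldr; lookup; tabulate)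
open import Data.List.Membership.Propositional using (_∈_)
open import Data.List.Membership.Propositional.Properties using (∈-lookup; ∈-filter⁺; ∈-filter⁻; ∈-tabulate⁺)
import Data.List.Relation.Unary.All as All
open import Data.List.Relation.Unary.AllPairs using ([]; _∷_)
open import Data.List.Relation.Unary.Any using (index)
open import Data.List.Relation.Unary.Any.Properties using (lookup-index)
open import Data.List.Relation.Unary.Unique.Propositional using (Unique)
import Data.List.Relation.Unary.Unique.Propositional.Properties as Unique
open import Data.Maybe.Base using (Maybe; just; nothing)
open import Data.Maybe.Properties using (just-injective)
open import Data.Nat.Base as ℕ using (ℕ; zero; suc)
open import Data.Nat.Divisibility using (_∣_; divides)
open import Data.Nat.DivMod using (_/_; _%_)
import Data.Nat.DivMod as ℕ
import Data.Nat.Properties as ℕ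
open import Data.Nat.Tactic.RingSolver using (solve-∀)
open import Data.Product.Base using (Σ; ∃; ∃-syntax; _×_; _,_; proj₁; proj₂)
open import Data.Sum.Base using (_⊎_; inj₁; inj₂)
open import Data.Sum.Function.Propositional using (_⊎-↔_)
open import Data.Unit.Polymorphic.Base using (⊤)
open import Data.Vec.Base as Vec using (Vec; []; _∷_; allFin)
open import Data.Vec.N-ary using (N-ary; _$ⁿ_)
open import Function.Base using (_∘_; case_of_)
open import Function.Bundles using (_↔_; Injection; Inverse; mk↔ₛ′; mk⤖)
open import Function.Construct.Composition using (_↔-∘_)
open import Function.Definitions using (Bijective; Injective)
open import Function.Properties.Bijection using (⤖⇒↔)
open import Function.Properties.Inverse using (↔⇒↣; ↔-refl; ↔-sym)
open import Level using (Level; _⊔_)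
open import Relation.Binary.Core using (Rel)
open import Relation.Binary.Definitions using (tri<; tri≈; tri>)
open import Relation.Binary.PropositionalEquality using (_≡_; _≢_; refl; sym; trans; cong; cong₂; subst; module ≡-Reasoning)
open import Relation.Binary.Structures using (IsTotalOrder)
open import Relation.Nullary.Decidable.Core using (Dec; yes; no; decidable-stable; _×-dec_; ¬?; map′)
open import Relation.Nullary.Negation.Core using (¬_; contradiction)
open import Relation.Unary using (Pred; Decidable)
open import Tactic.RingSolver.Core.AlmostCommutativeRing using (fromCommutativeRing)
open import Tactic.RingSolver.Core.Polynomial.Parameters using (Homomorphism)

-- The bridge between the group law and algebra is the pair `≅E₃⇒torsion`, `torsion⇒≅E₃`: an
-- isomorphism `φ : E ≅ E₃ a b` with `b ≢ 0#` carries a point of order 3 in its parameters, namely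
-- `(r φ , t φ)`, and every affine 3-torsion point arises in this way. Moving torsion along an
-- isomorphism is then composition of parameters, and finding the torsion of `E₃ a b` is solving the
-- equations of `_≅_`. These are polynomial identities modulo hypotheses, each certified by explicit
-- multipliers. To exclude that `a³ - 27b` is a cube, it suffices to exhibit four distinct torsion
-- points, one more than `Fin 3` can hold. The condition `q ≡ 1 (mod 3)` enters through counting:
-- summing all field elements gives `3 ≢ 0`, a permutation of order 3 gives a primitive cube root of
-- unity, and the pigeonhole principle, in place of cyclicity of the multiplicative group, gives the
-- three cosets of the cubes.

-- Certified polynomial identities over a commutative ring

module IntegerCoefficients {c ℓ : Level} (R : CommutativeRing c ℓ) where
  open import Data.Integer.Base as ℤ using (ℤ; +_; -[1+_])
  open CommutativeRing R renaming (refl to ≈-refl; sym to ≈-sym; trans to ≈-trans)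
  open import Algebra.Definitions.RawSemiring (Semiring.rawSemiring semiring) using (_^_) renaming (_×_ to _·_)
  open import Algebra.Properties.AbelianGroup +-abelianGroup
    using (⁻¹-involutive; ⁻¹-∙-comm; ε⁻¹≈ε; x≈y⇒x∙y⁻¹≈ε; x∙y⁻¹≈ε⇒x≈y)
  open import Algebra.Properties.Ring ring using (-‿distribˡ-*; -‿distribʳ-*)
  open import Algebra.Properties.Semiring.Mult semiring using (×-homo-+; ×1-homo-*; ×-assoc-*; ×-congʳ)
  open import Algebra.Properties.Semiring.Exp semiring using (^-congˡ)
  open import Relation.Binary.Reasoning.Setoid setoid

  ⟦_⟧ℤ : ℤ → Carrier
  ⟦ + n ⟧ℤ = n · 1#
  ⟦ -[1+ n ] ⟧ℤ = - (suc n · 1#)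

  ⟦⟧ℤ-‿homo : ∀ i → ⟦ ℤ.- i ⟧ℤ ≈ - ⟦ i ⟧ℤ
  ⟦⟧ℤ-‿homo (+ zero) = ≈-sym ε⁻¹≈ε
  ⟦⟧ℤ-‿homo (+ suc n) = ≈-refl
  ⟦⟧ℤ-‿homo -[1+ n ] = ≈-sym (⁻¹-involutive _)

  ⟦⟧ℤ-⊖-homo : ∀ m n → ⟦ m ℤ.⊖ n ⟧ℤ ≈ m · 1# - n · 1#
  ⟦⟧ℤ-⊖-homo m zero = ≈-sym (≈-trans (+-congˡ ε⁻¹≈ε) (+-identityʳ _))
  ⟦⟧ℤ-⊖-homo zero (suc n) = ≈-sym (+-identityˡ _)
  ⟦⟧ℤ-⊖-homo (suc m) (suc n) = begin
    ⟦ suc m ℤ.⊖ suc n ⟧ℤ                ≡⟨ cong ⟦_⟧ℤ (ℤ.[1+m]⊖[1+n]≡m⊖n m n) ⟩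
    ⟦ m ℤ.⊖ n ⟧ℤ                        ≈⟨ ⟦⟧ℤ-⊖-homo m n ⟩
    M - N                               ≈⟨ +-congʳ (+-identityʳ M) ⟨
    (M + 0#) - N                        ≈⟨ +-congʳ (+-congˡ (-‿inverseʳ 1#)) ⟨
    (M + (1# - 1#)) - N                 ≈⟨ +-congʳ (+-assoc _ _ _) ⟨
    ((M + 1#) - 1#) - N                 ≈⟨ +-assoc _ _ _ ⟩
    (M + 1#) + (- 1# - N)               ≈⟨ +-cong (+-comm _ _) (⁻¹-∙-comm _ _) ⟩
    (1# + M) - (1# + N)                 ∎
    where
    M = m · 1#
    N = n · 1#

  ⟦⟧ℤ-+-homo : ∀ i j → ⟦ i ℤ.+ j ⟧ℤ ≈ ⟦ i ⟧ℤ + ⟦ j ⟧ℤ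
  ⟦⟧ℤ-+-homo (+ m) (+ n) = ×-homo-+ 1# m n
  ⟦⟧ℤ-+-homo (+ m) -[1+ n ] = ⟦⟧ℤ-⊖-homo m (suc n)
  ⟦⟧ℤ-+-homo -[1+ m ] (+ n) = ≈-trans (⟦⟧ℤ-⊖-homo n (suc m)) (+-comm _ _)
  ⟦⟧ℤ-+-homo -[1+ m ] -[1+ n ] = begin
    - (suc (suc (m ℕ.+ n)) · 1#)        ≡⟨ cong (λ k → - (suc k · 1#)) (ℕ.+-suc m n) ⟨
    - ((suc m ℕ.+ suc n) · 1#)          ≈⟨ -‿cong (×-homo-+ 1# (suc m) (suc n)) ⟩
    - (suc m · 1# + suc n · 1#)         ≈⟨ ⁻¹-∙-comm _ _ ⟨
    - (suc m · 1#) - suc n · 1#         ∎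

  ⟦⟧ℤ-*-homo⁺ : ∀ m j → ⟦ + m ℤ.* j ⟧ℤ ≈ m · 1# * ⟦ j ⟧ℤ
  ⟦⟧ℤ-*-homo⁺ m (+ n) = ≈-trans (reflexive (cong ⟦_⟧ℤ (sym (ℤ.pos-* m n)))) (×1-homo-* m n)
  ⟦⟧ℤ-*-homo⁺ m -[1+ n ] = begin
    ⟦ + m ℤ.* -[1+ n ] ⟧ℤ               ≡⟨ cong ⟦_⟧ℤ (ℤ.neg-distribʳ-* (+ m) (+ suc n)) ⟨
    ⟦ ℤ.- (+ m ℤ.* + suc n) ⟧ℤ          ≈⟨ ⟦⟧ℤ-‿homo (+ m ℤ.* + suc n) ⟩
    - ⟦ + m ℤ.* + suc n ⟧ℤ              ≈⟨ -‿cong (⟦⟧ℤ-*-homo⁺ m (+ suc n)) ⟩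
    - (m · 1# * (suc n · 1#))           ≈⟨ -‿distribʳ-* _ _ ⟩
    m · 1# * - (suc n · 1#)             ∎

  ⟦⟧ℤ-*-homo : ∀ i j → ⟦ i ℤ.* j ⟧ℤ ≈ ⟦ i ⟧ℤ * ⟦ j ⟧ℤ
  ⟦⟧ℤ-*-homo (+ m) j = ⟦⟧ℤ-*-homo⁺ m j
  ⟦⟧ℤ-*-homo -[1+ m ] j = begin
    ⟦ -[1+ m ] ℤ.* j ⟧ℤ                 ≡⟨ cong ⟦_⟧ℤ (ℤ.neg-distribˡ-* (+ suc m) j) ⟨
    ⟦ ℤ.- (+ suc m ℤ.* j) ⟧ℤ            ≈⟨ ⟦⟧ℤ-‿homo (+ suc m ℤ.* j) ⟩
    - ⟦ + suc m ℤ.* j ⟧ℤ                ≈⟨ -‿cong (⟦⟧ℤ-*-homo⁺ (suc m) j) ⟩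
    - (suc m · 1# * ⟦ j ⟧ℤ)             ≈⟨ -‿distribˡ-* _ _ ⟩
    - (suc m · 1#) * ⟦ j ⟧ℤ             ∎

  isZero : ℤ → Bool
  isZero (+ zero) = true
  isZero _        = false

  -- Cancellation in normal forms needs a zero test that computes on closed terms. Integer
  -- coefficients provide one whatever `R` is; the test on `R` itself always answers `nothing`.
  homomorphism : Homomorphism _ _ _ _
  homomorphism = record
    { from = record { rawRing = ℤ.+-*-rawRing ; isZero = isZero }
    ; to = fromCommutativeRing R (λ _ → nothing)
    ; morphism = record
      { ⟦_⟧ = ⟦_⟧ℤ ; +-homo = ⟦⟧ℤ-+-homo ; *-homo = ⟦⟧ℤ-*-homo ; -‿homo = ⟦⟧ℤ-‿homo
      ; 0-homo = ≈-refl ; 1-homo = +-identityʳ 1# }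
    ; Zero-C⟶Zero-R = λ { (+ zero) _ → ≈-refl }
    }

  open import Tactic.RingSolver.Core.Polynomial.Base (Homomorphism.from homomorphism)
  open import Tactic.RingSolver.Core.Polynomial.Semantics homomorphism renaming (⟦_⟧ to ⟦_⟧ₚ)
  open import Tactic.RingSolver.Core.Polynomial.Homomorphism homomorphism

  infixl 6 _:+_ _:-_
  infixl 7 _:*_
  infix  8 :-_
  infixr 8 _:^_ _:·_
  infix  5 _:=_

  -- Powers and integer multiples are constructors so that `⟦_⟧` yields literally the `^` and `·`
  -- terms of the Weierstrass formulas, and hypotheses match by computation.
  data Expr (n : ℕ) : Set where
    var       : Fin n → Expr n
    :0 :1     : Expr n
    _:+_ _:*_ : (e f : Expr n) → Expr n
    :-_       : (e : Expr n) → Expr n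
    _:^_      : (e : Expr n) (k : ℕ) → Expr n
    _:·_      : (k : ℕ) (e : Expr n) → Expr n

  _:-_ : ∀ {n} → Expr n → Expr n → Expr n
  e :- f = e :+ (:- f)

  _:=_ : ∀ {n} → Expr n → Expr n → Expr n × Expr n
  _:=_ = _,_

  ⟦_⟧ : ∀ {n} → Expr n → Vec Carrier n → Carrier
  ⟦ var i ⟧ xs = Vec.lookup xs i
  ⟦ :0 ⟧ xs = 0#
  ⟦ :1 ⟧ xs = 1#
  ⟦ e :+ f ⟧ xs = ⟦ e ⟧ xs + ⟦ f ⟧ xs
  ⟦ e :* f ⟧ xs = ⟦ e ⟧ xs * ⟦ f ⟧ xs
  ⟦ :- e ⟧ xs = - ⟦ e ⟧ xs
  ⟦ e :^ k ⟧ xs = ⟦ e ⟧ xs ^ k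
  ⟦ k :· e ⟧ xs = k · ⟦ e ⟧ xs

  power : ∀ {n} → Poly n → ℕ → Poly n
  power p zero = κ (+ 1)
  power p (suc k) = p ⊠ power p k

  normalise : ∀ {n} → Expr n → Poly n
  normalise (var i) = ι i
  normalise :0 = κ (+ 0)
  normalise :1 = κ (+ 1)
  normalise (e :+ f) = normalise e ⊞ normalise f
  normalise (e :* f) = normalise e ⊠ normalise f
  normalise (:- e) = ⊟ normalise e
  normalise (e :^ k) = power (normalise e) k
  normalise (k :· e) = κ (+ k) ⊠ normalise e

  power-correct : ∀ {n} (p : Poly n) k xs → ⟦ power p k ⟧ₚ xs ≈ ⟦ p ⟧ₚ xs ^ k
  power-correct p zero xs = ≈-trans (κ-hom (+ 1) xs) (+-identityʳ 1#)
  power-correct p (suc k) xs = ≈-trans (⊠-hom p (power p k) xs) (*-congˡ (power-correct p k xs))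

  correct : ∀ {n} (e : Expr n) xs → ⟦ normalise e ⟧ₚ xs ≈ ⟦ e ⟧ xs
  correct (var i) xs = ι-hom i xs
  correct :0 xs = κ-hom (+ 0) xs
  correct :1 xs = ≈-trans (κ-hom (+ 1) xs) (+-identityʳ 1#)
  correct (e :+ f) xs = ≈-trans (⊞-hom (normalise e) (normalise f) xs) (+-cong (correct e xs) (correct f xs))
  correct (e :* f) xs = ≈-trans (⊠-hom (normalise e) (normalise f) xs) (*-cong (correct e xs) (correct f xs))
  correct (:- e) xs = ≈-trans (⊟-hom (normalise e) xs) (-‿cong (correct e xs))
  correct (e :^ k) xs = ≈-trans (power-correct (normalise e) k xs) (^-congˡ k (correct e xs))
  correct (k :· e) xs = begin
    ⟦ κ (+ k) ⊠ normalise e ⟧ₚ xs       ≈⟨ ⊠-hom (κ (+ k)) (normalise e) xs ⟩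
    ⟦ κ (+ k) ⟧ₚ xs * ⟦ normalise e ⟧ₚ xs ≈⟨ *-cong (κ-hom (+ k) xs) (correct e xs) ⟩
    k · 1# * ⟦ e ⟧ xs                   ≈⟨ ×-assoc-* k 1# _ ⟩
    k · (1# * ⟦ e ⟧ xs)                 ≈⟨ ×-congʳ k (*-identityˡ _) ⟩
    k · ⟦ e ⟧ xs                        ∎

  record Problem (n : ℕ) : Set where
    constructor _by_
    field
      goal  : Expr n × Expr n
      terms : List (Expr n × Expr n × Expr n)

  infix 3 _by_

  residue : ∀ {n} → Problem n → Expr n
  residue ((l , r) by ts) = l :- r :- foldr (λ (k , l′ , r′) e → k :* (l′ :- r′) :+ e) :0 ts

  -- The closing `⊤` is what the final `_` in each tuple of hypotheses fills.
  Hypotheses : ∀ {n} → List (Expr n × Expr n × Expr n) → Vec Carrier n → Set ℓ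
  Hypotheses [] xs = ⊤
  Hypotheses ((_ , l , r) ∷ ts) xs = ⟦ l ⟧ xs ≈ ⟦ r ⟧ xs × Hypotheses ts xs

  combination≈0 : ∀ {n} ts (xs : Vec Carrier n) → Hypotheses ts xs →
                  ⟦ foldr (λ (k , l , r) e → k :* (l :- r) :+ e) :0 ts ⟧ xs ≈ 0#
  combination≈0 [] xs _ = ≈-refl
  combination≈0 ((k , l , r) ∷ ts) xs (l≈r , hs) = begin
    ⟦ k ⟧ xs * (⟦ l ⟧ xs - ⟦ r ⟧ xs) + _  ≈⟨ +-cong (*-congˡ (x≈y⇒x∙y⁻¹≈ε l≈r)) (combination≈0 ts xs hs) ⟩
    ⟦ k ⟧ xs * 0# + 0#                    ≈⟨ +-identityʳ _ ⟩
    ⟦ k ⟧ xs * 0#                         ≈⟨ zeroʳ _ ⟩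
    0#                                    ∎

  -- Derives the goal l ≈ r from hypotheses lᵢ ≈ rᵢ and multipliers kᵢ with
  -- l - r = Σ kᵢ (lᵢ - rᵢ). The identity is checked on closed normal forms, so
  -- that nothing in R is unfolded.
  linear-combination : ∀ {n} (xs : Vec Carrier n) (f : N-ary n (Expr n) (Problem n)) →
    let goal by ts = f $ⁿ Vec.map var (allFin n) in
    normalise (residue (goal by ts)) ≡ κ (+ 0) →
    Hypotheses ts xs → ⟦ proj₁ goal ⟧ xs ≈ ⟦ proj₂ goal ⟧ xs
  linear-combination {n} xs f residue≡0 hs = x∙y⁻¹≈ε⇒x≈y _ _ (begin
    ⟦ l ⟧ xs - ⟦ r ⟧ xs                            ≈⟨ +-identityʳ _ ⟨
    ⟦ l ⟧ xs - ⟦ r ⟧ xs + 0#                       ≈⟨ +-congˡ ε⁻¹≈ε ⟨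
    ⟦ l ⟧ xs - ⟦ r ⟧ xs - 0#                       ≈⟨ +-congˡ (-‿cong (combination≈0 ts xs hs)) ⟨
    ⟦ residue p ⟧ xs                               ≈⟨ correct (residue p) xs ⟨
    ⟦ normalise (residue p) ⟧ₚ xs                  ≡⟨ cong (λ e → ⟦ e ⟧ₚ xs) residue≡0 ⟩
    ⟦ κ (+ 0) ⟧ₚ xs                                ≈⟨ κ-hom (+ 0) xs ⟩
    0#                                             ∎)
    where
    p = f $ⁿ Vec.map var (allFin n)
    l = proj₁ (Problem.goal p)
    r = proj₂ (Problem.goal p)
    ts = Problem.terms p

-- Field arithmetic

module FieldProperties {c : Level} (F : FiniteField c) where
  open FiniteField F
  open CommutativeRing commutativeRing public
    using (zeroˡ; zeroʳ; *-comm; *-assoc; *-identityˡ; *-identityʳ)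
  open IntegerCoefficients commutativeRing public

  cancel : ∀ {x y} → x ≢ 0# → x * y ≡ 0# → y ≡ 0#
  cancel {x} {y} x≢0 xy≡0 = linear-combination (x ∷ y ∷ x ⁻¹ ∷ [])
    (λ x y i → y := :0 by (:- y , x :* i := :1) ∷ (i , x :* y := :0) ∷ []) refl
    (*-inverseʳ x x≢0 , xy≡0 , _)

  1≢0 : 1# ≢ 0#
  1≢0 1≡0 = 0≢1 (sym 1≡0)

  -x≡0⇒x≡0 : ∀ {x} → - x ≡ 0# → x ≡ 0#
  -x≡0⇒x≡0 {x} -x≡0 = linear-combination (x ∷ []) (λ x → x := :0 by (:- :1 , :- x := :0) ∷ []) refl (-x≡0 , _)

  *-≢0 : ∀ {x y} → x ≢ 0# → y ≢ 0# → x * y ≢ 0#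
  *-≢0 x≢0 y≢0 xy≡0 = y≢0 (cancel x≢0 xy≡0)

  ^-≢0 : ∀ {x} n → x ≢ 0# → x ^ n ≢ 0#
  ^-≢0 zero    x≢0     = 1≢0
  ^-≢0 (suc n) x≢0     = *-≢0 x≢0 (^-≢0 n x≢0)

  ⁻¹-≢0 : ∀ {x} → x ≢ 0# → x ⁻¹ ≢ 0#
  ⁻¹-≢0 {x} x≢0 i≡0 = 0≢1 (trans (sym (zeroʳ x)) (trans (cong (x *_) (sym i≡0)) (*-inverseʳ x x≢0)))

  *-cancelˡ : ∀ {x y z} → x ≢ 0# → x * y ≡ x * z → y ≡ z
  *-cancelˡ {x} {y} {z} x≢0 eq = linear-combination (x ∷ y ∷ z ∷ x ⁻¹ ∷ [])
    (λ x y z i → y := z by (z :- y , x :* i := :1) ∷ (i , x :* y := x :* z) ∷ []) refl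
    (*-inverseʳ x x≢0 , eq , _)

-- Composition and inversion of changes of variables

module Curves {c : Level} (F : FiniteField c) where
  open FiniteField F
  open FieldProperties F
  open EllipticCurves F
  open _≅_

  -- rhsᵢ is the right-hand side of the equation aᵢ-eq of _≅_.
  rhs₁ : ∀ {n} (a₁ s : Expr n) → Expr n
  rhs₁ a₁ s = a₁ :+ 2 :· s

  rhs₂ : ∀ {n} (a₁ a₂ r s : Expr n) → Expr n
  rhs₂ a₁ a₂ r s = a₂ :- s :* a₁ :+ 3 :· r :- s :^ 2

  rhs₃ : ∀ {n} (a₁ a₃ r t : Expr n) → Expr n
  rhs₃ a₁ a₃ r t = a₃ :+ r :* a₁ :+ 2 :· t

  rhs₄ : ∀ {n} (a₁ a₂ a₃ a₄ r s t : Expr n) → Expr n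
  rhs₄ a₁ a₂ a₃ a₄ r s t =
    a₄ :- s :* a₃ :+ 2 :· r :* a₂ :- (t :+ r :* s) :* a₁ :+ 3 :· r :^ 2 :- 2 :· s :* t

  rhs₆ : ∀ {n} (a₁ a₂ a₃ a₄ a₆ r t : Expr n) → Expr n
  rhs₆ a₁ a₂ a₃ a₄ a₆ r t =
    a₆ :+ r :* a₄ :+ r :^ 2 :* a₂ :+ r :^ 3 :- t :* a₃ :- t :^ 2 :- r :* t :* a₁

  -- The parameters come from substituting one change of variables into the other. An equation of
  -- `ψ`, times a power of `u φ`, still contains coefficients of the middle curve; the remaining
  -- multipliers eliminate these with the equations of `φ`.
  ≅-trans : ∀ {E₁ E₂ E₃} → E₁ ≅ E₂ → E₂ ≅ E₃ → E₁ ≅ E₃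
  ≅-trans {weierstrass a₁ a₂ a₃ a₄ a₆} {weierstrass b₁ b₂ b₃ b₄ b₆} {weierstrass c₁ c₂ c₃ c₄ c₆} φ ψ = record
    { u = u φ * u ψ
    ; r = u φ ^ 2 * r ψ + r φ
    ; s = u φ * s ψ + s φ
    ; t = u φ ^ 3 * t ψ + s φ * u φ ^ 2 * r ψ + t φ
    ; u≢0 = *-≢0 (u≢0 φ) (u≢0 ψ)
    ; a₁-eq = linear-combination
        (u φ ∷ s φ ∷ u ψ ∷ s ψ ∷ a₁ ∷ b₁ ∷ c₁ ∷ [])
        (λ u s v s′ a₁ b₁ c₁ →
          (u :* v) :* c₁ := rhs₁ a₁ (u :* s′ :+ s)
          by (u , v :* c₁ := rhs₁ b₁ s′)
           ∷ (:1 , u :* b₁ := rhs₁ a₁ s) ∷ [])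
        refl (a₁-eq ψ , a₁-eq φ , _)
    ; a₂-eq = linear-combination
        (u φ ∷ r φ ∷ s φ ∷ u ψ ∷ r ψ ∷ s ψ ∷ a₁ ∷ a₂ ∷ b₁ ∷ b₂ ∷ c₂ ∷ [])
        (λ u r s v r′ s′ a₁ a₂ b₁ b₂ c₂ →
          (u :* v) :^ 2 :* c₂ := rhs₂ a₁ a₂ (u :^ 2 :* r′ :+ r) (u :* s′ :+ s)
          by (u :^ 2 , v :^ 2 :* c₂ := rhs₂ b₁ b₂ r′ s′)
           ∷ (:1 , u :^ 2 :* b₂ := rhs₂ a₁ a₂ r s)
           ∷ (:- (u :* s′) , u :* b₁ := rhs₁ a₁ s) ∷ [])
        refl (a₂-eq ψ , a₂-eq φ , a₁-eq φ , _)
    ; a₃-eq = linear-combination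
        (u φ ∷ r φ ∷ s φ ∷ t φ ∷ u ψ ∷ r ψ ∷ t ψ ∷ a₁ ∷ a₃ ∷ b₁ ∷ b₃ ∷ c₃ ∷ [])
        (λ u r s t v r′ t′ a₁ a₃ b₁ b₃ c₃ →
          (u :* v) :^ 3 :* c₃ := rhs₃ a₁ a₃ (u :^ 2 :* r′ :+ r) (u :^ 3 :* t′ :+ s :* u :^ 2 :* r′ :+ t)
          by (u :^ 3 , v :^ 3 :* c₃ := rhs₃ b₁ b₃ r′ t′)
           ∷ (:1 , u :^ 3 :* b₃ := rhs₃ a₁ a₃ r t)
           ∷ (u :^ 2 :* r′ , u :* b₁ := rhs₁ a₁ s) ∷ [])
        refl (a₃-eq ψ , a₃-eq φ , a₁-eq φ , _)
    ; a₄-eq = linear-combination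
        (u φ ∷ r φ ∷ s φ ∷ t φ ∷ u ψ ∷ r ψ ∷ s ψ ∷ t ψ ∷ a₁ ∷ a₂ ∷ a₃ ∷ a₄ ∷ b₁ ∷ b₂ ∷ b₃ ∷ b₄ ∷ c₄ ∷ [])
        (λ u r s t v r′ s′ t′ a₁ a₂ a₃ a₄ b₁ b₂ b₃ b₄ c₄ →
          (u :* v) :^ 4 :* c₄
            := rhs₄ a₁ a₂ a₃ a₄ (u :^ 2 :* r′ :+ r) (u :* s′ :+ s) (u :^ 3 :* t′ :+ s :* u :^ 2 :* r′ :+ t)
          by (u :^ 4 , v :^ 4 :* c₄ := rhs₄ b₁ b₂ b₃ b₄ r′ s′ t′)
           ∷ (:1 , u :^ 4 :* b₄ := rhs₄ a₁ a₂ a₃ a₄ r s t)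
           ∷ (:- (u :* s′) , u :^ 3 :* b₃ := rhs₃ a₁ a₃ r t)
           ∷ (2 :· (u :^ 2 :* r′) , u :^ 2 :* b₂ := rhs₂ a₁ a₂ r s)
           ∷ (:- (u :^ 3 :* (t′ :+ r′ :* s′)) , u :* b₁ := rhs₁ a₁ s) ∷ [])
        refl (a₄-eq ψ , a₄-eq φ , a₃-eq φ , a₂-eq φ , a₁-eq φ , _)
    ; a₆-eq = linear-combination
        (u φ ∷ r φ ∷ s φ ∷ t φ ∷ u ψ ∷ r ψ ∷ t ψ ∷ a₁ ∷ a₂ ∷ a₃ ∷ a₄ ∷ a₆ ∷ b₁ ∷ b₂ ∷ b₃ ∷ b₄ ∷ b₆ ∷ c₆ ∷ [])
        (λ u r s t v r′ t′ a₁ a₂ a₃ a₄ a₆ b₁ b₂ b₃ b₄ b₆ c₆ →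
          (u :* v) :^ 6 :* c₆
            := rhs₆ a₁ a₂ a₃ a₄ a₆ (u :^ 2 :* r′ :+ r) (u :^ 3 :* t′ :+ s :* u :^ 2 :* r′ :+ t)
          by (u :^ 6 , v :^ 6 :* c₆ := rhs₆ b₁ b₂ b₃ b₄ b₆ r′ t′)
           ∷ (:1 , u :^ 6 :* b₆ := rhs₆ a₁ a₂ a₃ a₄ a₆ r t)
           ∷ (u :^ 2 :* r′ , u :^ 4 :* b₄ := rhs₄ a₁ a₂ a₃ a₄ r s t)
           ∷ (:- (u :^ 3 :* t′) , u :^ 3 :* b₃ := rhs₃ a₁ a₃ r t)
           ∷ (u :^ 4 :* r′ :^ 2 , u :^ 2 :* b₂ := rhs₂ a₁ a₂ r s)
           ∷ (:- (u :^ 5 :* (r′ :* t′)) , u :* b₁ := rhs₁ a₁ s) ∷ [])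
        refl (a₆-eq ψ , a₆-eq φ , a₄-eq φ , a₃-eq φ , a₂-eq φ , a₁-eq φ , _)
    }

  -- Solving for the new coordinates gives `x′ = v²x - v²r` and `y′ = v³y - v³sx + v³(rs - t)` with
  -- `v = u⁻¹`. The equations of `φ` are solved for the coefficients of `E′` beforehand, so that the
  -- certificates involve `v` and not `u`.
  ≅-sym : ∀ {E E′} → E ≅ E′ → E′ ≅ E
  ≅-sym {weierstrass a₁ a₂ a₃ a₄ a₆} {weierstrass b₁ b₂ b₃ b₄ b₆} φ = record
    { u = v
    ; r = - (r φ * v ^ 2)
    ; s = - (s φ * v)
    ; t = (r φ * s φ - t φ) * v ^ 3
    ; u≢0 = ⁻¹-≢0 (u≢0 φ)
    ; a₁-eq = linear-combination
        (v ∷ s φ ∷ a₁ ∷ b₁ ∷ [])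
        (λ v s a₁ b₁ →
          v :* a₁ := rhs₁ b₁ (:- (s :* v))
          by (:- :1 , b₁ := v :* rhs₁ a₁ s) ∷ [])
        refl (b₁≡ , _)
    ; a₂-eq = linear-combination
        (v ∷ r φ ∷ s φ ∷ a₁ ∷ a₂ ∷ b₁ ∷ b₂ ∷ [])
        (λ v r s a₁ a₂ b₁ b₂ →
          v :^ 2 :* a₂ := rhs₂ b₁ b₂ (:- (r :* v :^ 2)) (:- (s :* v))
          by (:- :1 , b₂ := v :^ 2 :* rhs₂ a₁ a₂ r s)
           ∷ (:- (s :* v) , b₁ := v :* rhs₁ a₁ s) ∷ [])
        refl (b₂≡ , b₁≡ , _)
    ; a₃-eq = linear-combination
        (v ∷ r φ ∷ s φ ∷ t φ ∷ a₁ ∷ a₃ ∷ b₁ ∷ b₃ ∷ [])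
        (λ v r s t a₁ a₃ b₁ b₃ →
          v :^ 3 :* a₃ := rhs₃ b₁ b₃ (:- (r :* v :^ 2)) ((r :* s :- t) :* v :^ 3)
          by (:- :1 , b₃ := v :^ 3 :* rhs₃ a₁ a₃ r t)
           ∷ (r :* v :^ 2 , b₁ := v :* rhs₁ a₁ s) ∷ [])
        refl (b₃≡ , b₁≡ , _)
    ; a₄-eq = linear-combination
        (v ∷ r φ ∷ s φ ∷ t φ ∷ a₁ ∷ a₂ ∷ a₃ ∷ a₄ ∷ b₁ ∷ b₂ ∷ b₃ ∷ b₄ ∷ [])
        (λ v r s t a₁ a₂ a₃ a₄ b₁ b₂ b₃ b₄ →
          let r′ = :- (r :* v :^ 2)
              s′ = :- (s :* v)
              t′ = (r :* s :- t) :* v :^ 3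
          in
          v :^ 4 :* a₄ := rhs₄ b₁ b₂ b₃ b₄ r′ s′ t′
          by (:- :1 , b₄ := v :^ 4 :* rhs₄ a₁ a₂ a₃ a₄ r s t)
           ∷ (s′ , b₃ := v :^ 3 :* rhs₃ a₁ a₃ r t)
           ∷ (:- (2 :· r′) , b₂ := v :^ 2 :* rhs₂ a₁ a₂ r s)
           ∷ (t′ :+ r′ :* s′ , b₁ := v :* rhs₁ a₁ s) ∷ [])
        refl (b₄≡ , b₃≡ , b₂≡ , b₁≡ , _)
    ; a₆-eq = linear-combination
        (v ∷ r φ ∷ s φ ∷ t φ ∷ a₁ ∷ a₂ ∷ a₃ ∷ a₄ ∷ a₆ ∷ b₁ ∷ b₂ ∷ b₃ ∷ b₄ ∷ b₆ ∷ [])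
        (λ v r s t a₁ a₂ a₃ a₄ a₆ b₁ b₂ b₃ b₄ b₆ →
          let r′ = :- (r :* v :^ 2)
              t′ = (r :* s :- t) :* v :^ 3
          in
          v :^ 6 :* a₆ := rhs₆ b₁ b₂ b₃ b₄ b₆ r′ t′
          by (:- :1 , b₆ := v :^ 6 :* rhs₆ a₁ a₂ a₃ a₄ a₆ r t)
           ∷ (:- r′ , b₄ := v :^ 4 :* rhs₄ a₁ a₂ a₃ a₄ r s t)
           ∷ (t′ , b₃ := v :^ 3 :* rhs₃ a₁ a₃ r t)
           ∷ (:- (r′ :^ 2) , b₂ := v :^ 2 :* rhs₂ a₁ a₂ r s)
           ∷ (r′ :* t′ , b₁ := v :* rhs₁ a₁ s) ∷ [])
        refl (b₆≡ , b₄≡ , b₃≡ , b₂≡ , b₁≡ , _)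
    }
    where
    v = u φ ⁻¹

    v^n*u^n≡1 : ∀ n → v ^ n * u φ ^ n ≡ 1#
    v^n*u^n≡1 zero = *-identityˡ 1#
    v^n*u^n≡1 (suc n) = linear-combination (u φ ∷ v ∷ u φ ^ n ∷ v ^ n ∷ [])
      (λ u v x y → (v :* y) :* (u :* x) := :1 by (u :* v , y :* x := :1) ∷ (:1 , u :* v := :1) ∷ []) refl
      (v^n*u^n≡1 n , *-inverseʳ (u φ) (u≢0 φ) , _)

    isolate : ∀ n {b x} → u φ ^ n * b ≡ x → b ≡ v ^ n * x
    isolate n {b} {x} eq = linear-combination (u φ ^ n ∷ v ^ n ∷ b ∷ x ∷ [])
      (λ uⁿ vⁿ b x → b := vⁿ :* x by (vⁿ , uⁿ :* b := x) ∷ (:- b , vⁿ :* uⁿ := :1) ∷ []) refl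
      (eq , v^n*u^n≡1 n , _)

    -- `a₁-eq` contains `u`, whereas `isolate 1` would ask for `u ^ 1`, which is `u * 1#`.
    b₁≡ : b₁ ≡ v * (a₁ + 2 · s φ)
    b₁≡ = linear-combination (u φ ∷ v ∷ a₁ ∷ s φ ∷ b₁ ∷ [])
      (λ u v a₁ s b₁ → b₁ := v :* rhs₁ a₁ s by (v , u :* b₁ := rhs₁ a₁ s) ∷ (:- b₁ , u :* v := :1) ∷ []) refl
      (a₁-eq φ , *-inverseʳ (u φ) (u≢0 φ) , _)
    b₂≡ = isolate 2 (a₂-eq φ)
    b₃≡ = isolate 3 (a₃-eq φ)
    b₄≡ = isolate 4 (a₄-eq φ)
    b₆≡ = isolate 6 (a₆-eq φ)

-- Points of order 3 as isomorphisms onto curves `E₃ a b`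

module Torsion₃ {c : Level} (F : FiniteField c) where
  open FiniteField F
  open FieldProperties F
  open Curves F
  open EllipticCurves F
  open _≅_

  E₃ : Carrier → Carrier → WeierstrassCurve
  E₃ a b = weierstrass a 0# b 0# 0#

  module _ (E : WeierstrassCurve) where
    open WeierstrassCurve E using (a₁; a₂; a₃; a₄; a₆)

    private
      infixl 6 _⊞_
      _⊞_ = _⊕_ E

    tangent : Carrier → Carrier → Carrier
    tangent x y = (3 · x ^ 2 + 2 · a₂ * x + a₄ - a₁ * y) * (2 · y + a₁ * x + a₃) ⁻¹

    ⊕-opposite : ∀ {x y₁ y₂} → y₁ + y₂ + a₁ * x + a₃ ≡ 0# → affine x y₁ ⊞ affine x y₂ ≡ ∞
    ⊕-opposite {x} {y₁} {y₂} opp with x ≟ x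
    ... | no x≢x = contradiction refl x≢x
    ... | yes _ with y₁ + y₂ + a₁ * x + a₃ ≟ 0#
    ...   | yes _ = refl
    ...   | no ¬opp = contradiction opp ¬opp

    -- A chord is always an affine point, so `∞` can only come from the branch for opposite points.
    ⊕-opposite⁻¹ : ∀ {x₁ y₁ x₂ y₂} → affine x₁ y₁ ⊞ affine x₂ y₂ ≡ ∞ →
                   x₁ ≡ x₂ × y₁ + y₂ + a₁ * x₂ + a₃ ≡ 0#
    ⊕-opposite⁻¹ {x₁} {y₁} {x₂} {y₂} eq with x₁ ≟ x₂
    ⊕-opposite⁻¹ {x₁} {y₁} {x₂} {y₂} () | no _
    ... | yes x₁≡x₂ with y₁ + y₂ + a₁ * x₂ + a₃ ≟ 0#
    ...   | yes opp = x₁≡x₂ , opp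
    ⊕-opposite⁻¹ {x₁} {y₁} {x₂} {y₂} () | yes _ | no _

    ⊕-double : ∀ {x y} → y + y + a₁ * x + a₃ ≢ 0# →
               affine x y ⊞ affine x y ≡ chord E (tangent x y) x y x
    ⊕-double {x} {y} ¬opp with x ≟ x
    ... | no x≢x = contradiction refl x≢x
    ... | yes _ with y + y + a₁ * x + a₃ ≟ 0#
    ...   | yes opp = contradiction opp ¬opp
    ...   | no _ = refl

  -- As `a₂`, `a₄`, `a₆` vanish on the target, three equations of `φ` speak of `P = (r φ , t φ)`:
  -- that of `a₆` puts `P` on `E`, that of `a₄` makes `s φ` the slope of the tangent at `P`, and
  -- that of `a₂` makes this tangent meet `E` in `P` three times. Hence `2P = -P`. The equation of
  -- `a₃` turns `b ≢ 0#` into a nonzero denominator of the slope.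
  ≅E₃⇒torsion : ∀ {E a b} (φ : E ≅ E₃ a b) → b ≢ 0# → Torsion E 3 (affine (r φ) (t φ))
  ≅E₃⇒torsion {E@(weierstrass a₁ a₂ a₃ a₄ a₆)} {a} {b} φ b≢0 = onCurve , (begin
    P ⊞ (P ⊞ P)                       ≡⟨ cong (P ⊞_) (⊕-double E ¬opposite) ⟩
    P ⊞ affine x′ y′                  ≡⟨ cong (λ z → P ⊞ affine z y′) x′≡x ⟩
    P ⊞ affine x y′                   ≡⟨ ⊕-opposite E opposite ⟩
    ∞                                 ∎)
    where
    open ≡-Reasoning
    infixl 6 _⊞_
    _⊞_ = _⊕_ E
    x = r φ
    y = t φ
    σ = s φ
    P = affine x y

    onCurve : OnCurve E P
    onCurve = linear-combination (u φ ∷ x ∷ y ∷ a₁ ∷ a₂ ∷ a₃ ∷ a₄ ∷ a₆ ∷ [])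
      (λ u x y a₁ a₂ a₃ a₄ a₆ →
        y :^ 2 :+ a₁ :* x :* y :+ a₃ :* y := x :^ 3 :+ a₂ :* x :^ 2 :+ a₄ :* x :+ a₆
        by (:1 , u :^ 6 :* :0 := rhs₆ a₁ a₂ a₃ a₄ a₆ x y) ∷ []) refl
      (a₆-eq φ , _)

    denominator : 2 · y + a₁ * x + a₃ ≡ u φ ^ 3 * b
    denominator = linear-combination (u φ ∷ b ∷ x ∷ y ∷ a₁ ∷ a₃ ∷ [])
      (λ u b x y a₁ a₃ →
        2 :· y :+ a₁ :* x :+ a₃ := u :^ 3 :* b
        by (:- :1 , u :^ 3 :* b := rhs₃ a₁ a₃ x y) ∷ []) refl
      (a₃-eq φ , _)

    denominator≢0 : 2 · y + a₁ * x + a₃ ≢ 0#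
    denominator≢0 d≡0 = *-≢0 (^-≢0 3 (u≢0 φ)) b≢0 (trans (sym denominator) d≡0)

    ¬opposite : y + y + a₁ * x + a₃ ≢ 0#
    ¬opposite o = denominator≢0 (linear-combination (x ∷ y ∷ a₁ ∷ a₃ ∷ [])
      (λ x y a₁ a₃ → 2 :· y :+ a₁ :* x :+ a₃ := :0
        by (:1 , y :+ y :+ a₁ :* x :+ a₃ := :0) ∷ []) refl (o , _))

    tangent≡σ : tangent E x y ≡ σ
    tangent≡σ = linear-combination
      (u φ ∷ x ∷ y ∷ σ ∷ a₁ ∷ a₂ ∷ a₃ ∷ a₄ ∷ (2 · y + a₁ * x + a₃) ⁻¹ ∷ [])
      (λ u x y σ a₁ a₂ a₃ a₄ i →
        (3 :· x :^ 2 :+ 2 :· a₂ :* x :+ a₄ :- a₁ :* y) :* i := σ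
        by (:- i , u :^ 4 :* :0 := rhs₄ a₁ a₂ a₃ a₄ x σ y)
         ∷ (σ , (2 :· y :+ a₁ :* x :+ a₃) :* i := :1) ∷ []) refl
      (a₄-eq φ , *-inverseʳ _ denominator≢0 , _)

    τ = tangent E x y
    x′ = τ ^ 2 + a₁ * τ - a₂ - x - x
    y′ = - (τ * (x′ - x) + y) - a₁ * x′ - a₃

    x′≡x : x′ ≡ x
    x′≡x = trans (cong (λ z → z ^ 2 + a₁ * z - a₂ - x - x) tangent≡σ)
      (linear-combination (u φ ∷ x ∷ σ ∷ a₁ ∷ a₂ ∷ [])
        (λ u x σ a₁ a₂ → σ :^ 2 :+ a₁ :* σ :- a₂ :- x :- x := x
          by (:1 , u :^ 2 :* :0 := rhs₂ a₁ a₂ x σ) ∷ []) refl (a₂-eq φ , _))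

    opposite : y + y′ + a₁ * x + a₃ ≡ 0#
    opposite = linear-combination (x ∷ y ∷ x′ ∷ τ ∷ a₁ ∷ a₃ ∷ [])
      (λ x y x′ τ a₁ a₃ →
        y :+ (:- (τ :* (x′ :- x) :+ y) :- a₁ :* x′ :- a₃) :+ a₁ :* x :+ a₃ := :0
        by (:- (τ :+ a₁) , x′ := x) ∷ []) refl (x′≡x , _)

  -- The same equations read backwards, with `u = 1` and the tangent slope as `s`: comparing
  -- abscissae in `2P = -P` gives the equation of `a₂`. The equalities for `r φ` and `t φ` let a
  -- caller identify the given point with the parameters by matching on `refl`.
  torsion⇒≅E₃ : ∀ E {x y} → Torsion E 3 (affine x y) →
    ∃[ a ] ∃[ b ] b ≢ 0# × Σ (E ≅ E₃ a b) λ φ → r φ ≡ x × t φ ≡ y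
  torsion⇒≅E₃ E@(weierstrass a₁ a₂ a₃ a₄ a₆) {x} {y} (onCurve , 3P≡∞)
    with y + y + a₁ * x + a₃ ≟ 0#
  -- If `2P = ∞`, then `3P` computes to `P`, which is affine.
  ... | yes opp = contradiction (trans (cong (_⊕_ E (affine x y)) (sym (⊕-opposite E opp))) 3P≡∞) λ ()
  ... | no ¬opp = a₁ + 2 · σ , d , d≢0 , φ , refl , refl
    where
    -- `d`, `den` and the sum tested against zero are one quantity, in the shapes used by `a₃-eq`,
    -- by `tangent` and by `_⊕_`.
    d = a₃ + x * a₁ + 2 · y
    den = 2 · y + a₁ * x + a₃
    σ = tangent E x y

    d≢0 : d ≢ 0#
    d≢0 d≡0 = ¬opp (linear-combination (x ∷ y ∷ a₁ ∷ a₃ ∷ [])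
      (λ x y a₁ a₃ → y :+ y :+ a₁ :* x :+ a₃ := :0 by (:1 , rhs₃ a₁ a₃ x y := :0) ∷ []) refl (d≡0 , _))

    den≢0 : den ≢ 0#
    den≢0 d≡0 = d≢0 (linear-combination (x ∷ y ∷ a₁ ∷ a₃ ∷ [])
      (λ x y a₁ a₃ → rhs₃ a₁ a₃ x y := :0 by (:1 , 2 :· y :+ a₁ :* x :+ a₃ := :0) ∷ []) refl (d≡0 , _))

    x≡x′ : x ≡ σ ^ 2 + a₁ * σ - a₂ - x - x
    x≡x′ = proj₁ (⊕-opposite⁻¹ E (trans (cong (_⊕_ E (affine x y)) (sym (⊕-double E ¬opp))) 3P≡∞))

    φ : E ≅ E₃ (a₁ + 2 · σ) d
    φ = record
      { u = 1# ; r = x ; s = σ ; t = y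
      ; u≢0 = 1≢0
      ; a₁-eq = *-identityˡ _
      ; a₂-eq = linear-combination (x ∷ σ ∷ a₁ ∷ a₂ ∷ [])
          (λ x σ a₁ a₂ → :1 :^ 2 :* :0 := rhs₂ a₁ a₂ x σ
            by (:- :1 , x := σ :^ 2 :+ a₁ :* σ :- a₂ :- x :- x) ∷ []) refl (x≡x′ , _)
      ; a₃-eq = linear-combination (x ∷ y ∷ a₁ ∷ a₃ ∷ [])
          (λ x y a₁ a₃ → :1 :^ 3 :* rhs₃ a₁ a₃ x y := rhs₃ a₁ a₃ x y by []) refl _
      ; a₄-eq = linear-combination (x ∷ y ∷ a₁ ∷ a₂ ∷ a₃ ∷ a₄ ∷ den ⁻¹ ∷ [])
          (λ x y a₁ a₂ a₃ a₄ i →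
            let ν = 3 :· x :^ 2 :+ 2 :· a₂ :* x :+ a₄ :- a₁ :* y
            in
            :1 :^ 4 :* :0 := rhs₄ a₁ a₂ a₃ a₄ x (ν :* i) y
            by (ν , (2 :· y :+ a₁ :* x :+ a₃) :* i := :1) ∷ []) refl
          (*-inverseʳ den den≢0 , _)
      ; a₆-eq = linear-combination (x ∷ y ∷ a₁ ∷ a₂ ∷ a₃ ∷ a₄ ∷ a₆ ∷ [])
          (λ x y a₁ a₂ a₃ a₄ a₆ →
            :1 :^ 6 :* :0 := rhs₆ a₁ a₂ a₃ a₄ a₆ x y
            by (:1 , y :^ 2 :+ a₁ :* x :* y :+ a₃ :* y := x :^ 3 :+ a₂ :* x :^ 2 :+ a₄ :* x :+ a₆) ∷ []) refl
          (onCurve , _)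
      }

-- Transport of torsion, particular isomorphisms, discriminants

module Cyclic₃ {c : Level} (F : FiniteField c) where
  open FiniteField F
  open FieldProperties F
  open Curves F
  open Torsion₃ F
  open EllipticCurves F
  open WeierstrassCurve using (Δ)
  open _≅_

  -- Contravariant: `φ` expresses the coordinates on `E` through those on `E′`.
  transport : ∀ {E E′} → E ≅ E′ → Point → Point
  transport φ ∞ = ∞
  transport φ (affine x y) = affine (u φ ^ 2 * x + r φ) (u φ ^ 3 * y + s φ * u φ ^ 2 * x + t φ)

  -- An affine torsion point of `E′` is `(r ψ , t ψ)` for some `ψ`, and its image is by definition
  -- the pair `(r , t)` of `≅-trans φ ψ`.
  transport-torsion : ∀ {E E′} (φ : E ≅ E′) P → Torsion E′ 3 P → Torsion E 3 (transport φ P)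
  transport-torsion φ ∞ _ = _ , refl
  transport-torsion {E′ = E′} φ (affine x y) tor
    with a , b , b≢0 , ψ , refl , refl ← torsion⇒≅E₃ E′ tor = ≅E₃⇒torsion (≅-trans φ ψ) b≢0

  affine-injective : ∀ {x y x′ y′} → affine x y ≡ affine x′ y′ → x ≡ x′ × y ≡ y′
  affine-injective refl = refl , refl

  transport-injective : ∀ {E E′} (φ : E ≅ E′) {P Q} → transport φ P ≡ transport φ Q → P ≡ Q
  transport-injective φ {∞} {∞} _ = refl
  transport-injective φ {affine x y} {affine x′ y′} eq = cong₂ affine x≡x′ y≡y′
    where
    x≡x′ : x ≡ x′
    x≡x′ = *-cancelˡ (^-≢0 2 (u≢0 φ)) (linear-combination (u φ ^ 2 ∷ r φ ∷ x ∷ x′ ∷ [])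
      (λ v r x x′ → v :* x := v :* x′ by (:1 , v :* x :+ r := v :* x′ :+ r) ∷ []) refl
      (proj₁ (affine-injective eq) , _))

    y≡y′ : y ≡ y′
    y≡y′ = *-cancelˡ (^-≢0 3 (u≢0 φ)) (linear-combination
      (u φ ^ 3 ∷ s φ * u φ ^ 2 ∷ t φ ∷ x ∷ x′ ∷ y ∷ y′ ∷ [])
      (λ v w t x x′ y y′ → v :* y := v :* y′
        by (:1 , v :* y :+ w :* x :+ t := v :* y′ :+ w :* x′ :+ t) ∷ (:- w , x := x′) ∷ []) refl
      (proj₂ (affine-injective eq) , x≡x′ , _))

  scaling : ∀ {v a b a′ b′} → v ≢ 0# → v * a′ ≡ a → v ^ 3 * b′ ≡ b → E₃ a b ≅ E₃ a′ b′
  scaling {v} {a} {b} {a′} {b′} v≢0 va′≡a v³b′≡b = record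
    { u = v ; r = 0# ; s = 0# ; t = 0#
    ; u≢0 = v≢0
    ; a₁-eq = linear-combination (v ∷ a ∷ a′ ∷ [])
        (λ v a a′ → v :* a′ := rhs₁ a :0 by (:1 , v :* a′ := a) ∷ []) refl (va′≡a , _)
    ; a₂-eq = linear-combination (v ∷ a ∷ []) (λ v a → v :^ 2 :* :0 := rhs₂ a :0 :0 :0 by []) refl _
    ; a₃-eq = linear-combination (v ∷ a ∷ b ∷ b′ ∷ [])
        (λ v a b b′ → v :^ 3 :* b′ := rhs₃ a b :0 :0 by (:1 , v :^ 3 :* b′ := b) ∷ []) refl (v³b′≡b , _)
    ; a₄-eq = linear-combination (v ∷ a ∷ b ∷ []) (λ v a b → v :^ 4 :* :0 := rhs₄ a :0 b :0 :0 :0 :0 by []) refl _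
    ; a₆-eq = linear-combination (v ∷ a ∷ b ∷ []) (λ v a b → v :^ 6 :* :0 := rhs₆ a :0 b :0 :0 :0 :0 by []) refl _
    }

  -- The change `y = y′ - ax - b`. It serves to show that `(0 , -b)`, its `(r , t)`, is a torsion
  -- point.
  negation : ∀ a b → E₃ a b ≅ E₃ (- a) (- b)
  negation a b = record
    { u = 1# ; r = 0# ; s = - a ; t = - b
    ; u≢0 = 1≢0
    ; a₁-eq = linear-combination (a ∷ []) (λ a → :1 :* :- a := rhs₁ a (:- a) by []) refl _
    ; a₂-eq = linear-combination (a ∷ []) (λ a → :1 :^ 2 :* :0 := rhs₂ a :0 :0 (:- a) by []) refl _
    ; a₃-eq = linear-combination (a ∷ b ∷ []) (λ a b → :1 :^ 3 :* :- b := rhs₃ a b :0 (:- b) by []) refl _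
    ; a₄-eq = linear-combination (a ∷ b ∷ [])
        (λ a b → :1 :^ 4 :* :0 := rhs₄ a :0 b :0 :0 (:- a) (:- b) by []) refl _
    ; a₆-eq = linear-combination (a ∷ b ∷ [])
        (λ a b → :1 :^ 6 :* :0 := rhs₆ a :0 b :0 :0 :0 (:- b) by []) refl _
    }

  origin-torsion : ∀ {a b} → b ≢ 0# → Torsion (E₃ a b) 3 (affine 0# 0#)
  origin-torsion b≢0 = ≅E₃⇒torsion (scaling 1≢0 (*-identityˡ _) 1³b≡b) b≢0
    where
    1³b≡b : ∀ {b} → 1# ^ 3 * b ≡ b
    1³b≡b {b} = linear-combination (b ∷ []) (λ b → :1 :^ 3 :* b := b by []) refl _

  -origin-torsion : ∀ {a b} → b ≢ 0# → Torsion (E₃ a b) 3 (affine 0# (- b))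
  -origin-torsion {a} {b} b≢0 = ≅E₃⇒torsion (negation a b) (b≢0 ∘ -x≡0⇒x≡0)

  -- With N = α² + αε + ε² the curve E₃ 3α (α³ - ε³) has a flex at x = -N, for
  -- each choice of a cube root of unity ρ.
  second-flex : ∀ {ρ} α ε → ρ ^ 2 + ρ + 1# ≡ 0# →
    let N = α ^ 2 + α * ε + ε ^ 2
        σ = ρ * (α + 2 · ε) - (α - ε)
    in
    E₃ (3 · α) (α ^ 3 - ε ^ 3) ≅ E₃ (3 · α + 2 · σ) (- (ε * N * (1# + 2 · ρ)))
  second-flex {ρ} α ε ρ²+ρ+1≡0 = record
    { u = 1# ; r = - N ; s = σ ; t = (α - ρ * ε) * N
    ; u≢0 = 1≢0
    ; a₁-eq = *-identityˡ _
    ; a₂-eq = linear-combination xs (λ ρ α ε →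
          :1 :^ 2 :* :0 := rhs₂ (3 :· α) :0 (:- (:N α ε)) (:σ ρ α ε)
          by ((α :+ 2 :· ε) :^ 2 , ρ :^ 2 :+ ρ :+ :1 := :0) ∷ []) refl (ρ²+ρ+1≡0 , _)
    ; a₃-eq = linear-combination xs (λ ρ α ε →
          :1 :^ 3 :* (:- (ε :* :N α ε :* (:1 :+ 2 :· ρ)))
            := rhs₃ (3 :· α) (α :^ 3 :- ε :^ 3) (:- (:N α ε)) ((α :- ρ :* ε) :* :N α ε)
          by []) refl _
    ; a₄-eq = linear-combination xs (λ ρ α ε →
          :1 :^ 4 :* :0
            := rhs₄ (3 :· α) :0 (α :^ 3 :- ε :^ 3) :0 (:- (:N α ε)) (:σ ρ α ε) ((α :- ρ :* ε) :* :N α ε)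
          by (:- (2 :· ((α :+ 2 :· ε) :* ε :* :N α ε)) , ρ :^ 2 :+ ρ :+ :1 := :0) ∷ []) refl (ρ²+ρ+1≡0 , _)
    ; a₆-eq = linear-combination xs (λ ρ α ε →
          :1 :^ 6 :* :0
            := rhs₆ (3 :· α) :0 (α :^ 3 :- ε :^ 3) :0 :0 (:- (:N α ε)) ((α :- ρ :* ε) :* :N α ε)
          by (ε :^ 2 :* :N α ε :^ 2 , ρ :^ 2 :+ ρ :+ :1 := :0) ∷ []) refl (ρ²+ρ+1≡0 , _)
    }
    where
    xs = ρ ∷ α ∷ ε ∷ []
    N = α ^ 2 + α * ε + ε ^ 2
    σ = ρ * (α + 2 · ε) - (α - ε)

    :N : ∀ {n} (α ε : Expr n) → Expr n
    :N α ε = α :^ 2 :+ α :* ε :+ ε :^ 2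

    :σ : ∀ {n} (ρ α ε : Expr n) → Expr n
    :σ ρ α ε = ρ :* (α :+ 2 :· ε) :- (α :- ε)


  :Δ : ∀ {n} (a₁ a₂ a₃ a₄ a₆ : Expr n) → Expr n
  :Δ a₁ a₂ a₃ a₄ a₆ = 9 :· b₂ :* b₄ :* b₆ :- b₂ :^ 2 :* b₈ :- 8 :· b₄ :^ 3 :- 27 :· b₆ :^ 2
    where
    b₂ = a₁ :^ 2 :+ 4 :· a₂
    b₄ = 2 :· a₄ :+ a₁ :* a₃
    b₆ = a₃ :^ 2 :+ 4 :· a₆
    b₈ = a₁ :^ 2 :* a₆ :+ 4 :· a₂ :* a₆ :- a₁ :* a₃ :* a₄ :+ a₂ :* a₃ :^ 2 :- a₄ :^ 2

  Δ-E₃ : ∀ a b → Δ (E₃ a b) ≡ b ^ 3 * (a ^ 3 - 27 · b)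
  Δ-E₃ a b = linear-combination (a ∷ b ∷ [])
    (λ a b → :Δ a :0 b :0 :0 := b :^ 3 :* (a :^ 3 :- 27 :· b) by []) refl _

  -- The discriminant is homogeneous of weight 12 when `aᵢ` has weight `i`, and invariant under the
  -- translations by `r`, `s`, `t`.
  Δ-≅E₃ : ∀ {a b E} (φ : E₃ a b ≅ E) → u φ ^ 12 * Δ E ≡ b ^ 3 * (a ^ 3 - 27 · b)
  Δ-≅E₃ {a} {b} {E@(weierstrass a₁ a₂ a₃ a₄ a₆)} φ = begin
    v ^ 12 * Δ E
      ≡⟨ linear-combination (v ∷ a₁ ∷ a₂ ∷ a₃ ∷ a₄ ∷ a₆ ∷ []) (λ v a₁ a₂ a₃ a₄ a₆ →
           v :^ 12 :* :Δ a₁ a₂ a₃ a₄ a₆ := :Δ (v :* a₁) (v :^ 2 :* a₂) (v :^ 3 :* a₃) (v :^ 4 :* a₄) (v :^ 6 :* a₆)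
           by []) refl _ ⟩
    Δ (weierstrass (v * a₁) (v ^ 2 * a₂) (v ^ 3 * a₃) (v ^ 4 * a₄) (v ^ 6 * a₆))
      ≡⟨ cong Δ (weierstrass-cong (a₁-eq φ) (a₂-eq φ) (a₃-eq φ) (a₄-eq φ) (a₆-eq φ)) ⟩
    Δ (weierstrass _ _ _ _ _)
      ≡⟨ linear-combination (a ∷ b ∷ r φ ∷ s φ ∷ t φ ∷ []) (λ a b r s t →
           :Δ (rhs₁ a s) (rhs₂ a :0 r s) (rhs₃ a b r t) (rhs₄ a :0 b :0 r s t) (rhs₆ a :0 b :0 :0 r t)
             := b :^ 3 :* (a :^ 3 :- 27 :· b)
           by []) refl _ ⟩
    b ^ 3 * (a ^ 3 - 27 · b) ∎
    where
    open ≡-Reasoning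
    v = u φ
    weierstrass-cong : ∀ {a₁ a₂ a₃ a₄ a₆ b₁ b₂ b₃ b₄ b₆} →
      a₁ ≡ b₁ → a₂ ≡ b₂ → a₃ ≡ b₃ → a₄ ≡ b₄ → a₆ ≡ b₆ →
      weierstrass a₁ a₂ a₃ a₄ a₆ ≡ weierstrass b₁ b₂ b₃ b₄ b₆
    weierstrass-cong refl refl refl refl refl = refl

-- Cyclic 3-torsion and the condition that `a³ - 27b` is not a cube

module Classification {c : Level} (F : FiniteField c) where
  open FiniteField F
  open FieldProperties F
  open Curves F
  open Torsion₃ F
  open Cyclic₃ F
  open EllipticCurves F
  open _≅_

  ¬cube⇒≢0 : ∀ {x} → ¬ IsCube x → x ≢ 0#
  ¬cube⇒≢0 ¬cube refl = ¬cube (0# , linear-combination [] (:0 :^ 3 := :0 by []) refl _)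

  IsAdmissible : Carrier → Carrier → Set c
  IsAdmissible a b = ¬ IsCube (a ^ 3 - 27 · b)

  admissible⇒≢0 : ∀ {a b} → IsAdmissible a b → b ≢ 0#
  admissible⇒≢0 {a} adm refl = adm (a , linear-combination (a ∷ []) (λ a → a :^ 3 := a :^ 3 :- 27 :· :0 by []) refl _)

  quotient-cube : ∀ {x y d} → d ≢ 0# → x ^ 3 ≡ y * d ^ 3 → IsCube y
  quotient-cube {x} {y} {d} d≢0 eq = x * d ⁻¹ , linear-combination (x ∷ y ∷ d ∷ d ⁻¹ ∷ [])
    (λ x y d i → (x :* i) :^ 3 := y
      by (i :^ 3 , x :^ 3 := y :* d :^ 3)
       ∷ (y :* ((d :* i) :^ 2 :+ d :* i :+ :1) , d :* i := :1) ∷ []) refl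
    (eq , *-inverseʳ d d≢0 , _)

  -- A flex of E₃ a b other than the origin and its negative has as abscissa r a root of
  -- 3r³ + a²r² + 3abr + 3b², and 9b times this cubic is (3b + ar)³ - (a³ - 27b)r³.
  admissible⇒r≡0 : ∀ {a b a′ b′} → IsAdmissible a b → (φ : E₃ a b ≅ E₃ a′ b′) → r φ ≡ 0#
  admissible⇒r≡0 {a} {b} {a′} {b′} adm φ = decidable-stable (r φ ≟ 0#) λ r≢0 →
    adm (quotient-cube r≢0 (*-cancelˡ r≢0 (linear-combination
      (a ∷ b ∷ u φ ∷ r φ ∷ s φ ∷ t φ ∷ [])
      (λ a b u r s t →
        let d = 3 :· r :^ 2 :- t :* a
            η = 2 :· t :+ a :* r :+ b
        in
        r :* (3 :· b :+ a :* r) :^ 3 := r :* ((a :^ 3 :- 27 :· b) :* r :^ 3)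
        by (:- (9 :· b :* η :^ 2) , u :^ 2 :* :0 := rhs₂ a :0 r s)
         ∷ (9 :· b :* (d :+ s :* η :+ a :* η) , u :^ 4 :* :0 := rhs₄ a :0 b :0 r s t)
         ∷ (:- (9 :· b :* (a :^ 2 :+ 12 :· r)) , u :^ 6 :* :0 := rhs₆ a :0 b :0 :0 r t) ∷ []) refl
      (a₂-eq φ , a₄-eq φ , a₆-eq φ , _))))

  -- With `r = 0` the equation of `a₆` becomes `t² + bt = 0`.
  admissible⇒t : ∀ {a b a′ b′} → IsAdmissible a b → (φ : E₃ a b ≅ E₃ a′ b′) → t φ ≡ 0# ⊎ t φ ≡ - b
  admissible⇒t {a} {b} {a′} {b′} adm φ with t φ ≟ 0#
  ... | yes t≡0 = inj₁ t≡0
  ... | no t≢0 = inj₂ (*-cancelˡ t≢0 (linear-combination (a ∷ b ∷ u φ ∷ r φ ∷ t φ ∷ [])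
    (λ a b u r t → t :* t := t :* :- b
      by (:1 , u :^ 6 :* :0 := rhs₆ a :0 b :0 :0 r t) ∷ (r :^ 2 :- t :* a , r := :0) ∷ []) refl
    (a₆-eq φ , admissible⇒r≡0 adm φ , _)))

  -- With `r = 0` the equation of `a₄` determines `s`: it is `0` when `t = 0`, and `-a` when
  -- `t = -b`.
  ≅E₃⇒scaling : ∀ {a b a′ b′} → IsAdmissible a b → E₃ a b ≅ E₃ a′ b′ →
                ∃[ v ] v ≢ 0# × v * a′ ≡ a × v ^ 3 * b′ ≡ b
  ≅E₃⇒scaling {a} {b} {a′} {b′} adm φ with admissible⇒t adm φ
  ... | inj₁ t≡0 = u φ , u≢0 φ ,
    linear-combination (a ∷ a′ ∷ u φ ∷ s φ ∷ []) (λ a a′ u s →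
      u :* a′ := a by (:1 , u :* a′ := rhs₁ a s) ∷ (2 :· :1 , s := :0) ∷ []) refl
      (a₁-eq φ , s≡0 , _) ,
    linear-combination (a ∷ b ∷ b′ ∷ u φ ∷ r φ ∷ t φ ∷ []) (λ a b b′ u r t →
      u :^ 3 :* b′ := b by (:1 , u :^ 3 :* b′ := rhs₃ a b r t) ∷ (a , r := :0) ∷ (2 :· :1 , t := :0) ∷ []) refl
      (a₃-eq φ , admissible⇒r≡0 adm φ , t≡0 , _)
    where
    s≡0 : s φ ≡ 0#
    s≡0 = cancel (admissible⇒≢0 adm) (linear-combination (a ∷ b ∷ u φ ∷ r φ ∷ s φ ∷ t φ ∷ [])
      (λ a b u r s t → b :* s := :0
        by (:1 , u :^ 4 :* :0 := rhs₄ a :0 b :0 r s t)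
         ∷ (3 :· r :- s :* a , r := :0) ∷ (:- a :- 2 :· s , t := :0) ∷ []) refl
      (a₄-eq φ , admissible⇒r≡0 adm φ , t≡0 , _))
  -- Here `φ` is a scaling combined with negation of points, which changes the sign of both
  -- coefficients; hence `-u`.
  ... | inj₂ t≡-b = - u φ , u≢0 φ ∘ -x≡0⇒x≡0 ,
    linear-combination (a ∷ a′ ∷ u φ ∷ s φ ∷ []) (λ a a′ u s →
      :- u :* a′ := a by (:- :1 , u :* a′ := rhs₁ a s) ∷ (:- (2 :· :1) , s := :- a) ∷ []) refl
      (a₁-eq φ , s≡-a , _) ,
    linear-combination (a ∷ b ∷ b′ ∷ u φ ∷ r φ ∷ t φ ∷ []) (λ a b b′ u r t →
      (:- u) :^ 3 :* b′ := b
      by (:- :1 , u :^ 3 :* b′ := rhs₃ a b r t) ∷ (:- a , r := :0) ∷ (:- (2 :· :1) , t := :- b) ∷ []) refl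
      (a₃-eq φ , admissible⇒r≡0 adm φ , t≡-b , _)
    where
    s≡-a : s φ ≡ - a
    s≡-a = *-cancelˡ (admissible⇒≢0 adm) (linear-combination (a ∷ b ∷ u φ ∷ r φ ∷ s φ ∷ t φ ∷ [])
      (λ a b u r s t → b :* s := b :* :- a
        by (:- :1 , u :^ 4 :* :0 := rhs₄ a :0 b :0 r s t)
         ∷ (:- (3 :· r :- s :* a) , r := :0) ∷ (a :+ 2 :· s , t := :- b) ∷ []) refl
      (a₄-eq φ , admissible⇒r≡0 adm φ , t≡-b , _))

  -- An affine torsion point is the `(r φ , t φ)` of an isomorphism between curves `E₃`, so the
  -- constraints on `r φ` and `t φ` apply.
  admissible⇒torsion : ∀ {a b} → IsAdmissible a b → ∀ P → Torsion (E₃ a b) 3 P →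
                 P ≡ ∞ ⊎ P ≡ affine 0# 0# ⊎ P ≡ affine 0# (- b)
  admissible⇒torsion adm ∞ _ = inj₁ refl
  admissible⇒torsion {a} {b} adm (affine x y) tor
    with _ , _ , _ , φ , refl , refl ← torsion⇒≅E₃ (E₃ a b) tor
    with admissible⇒t adm φ
  ... | inj₁ t≡0  = inj₂ (inj₁ (cong₂ affine (admissible⇒r≡0 adm φ) t≡0))
  ... | inj₂ t≡-b = inj₂ (inj₂ (cong₂ affine (admissible⇒r≡0 adm φ) t≡-b))

  torsion-irrelevant : ∀ E n P (p q : Torsion E n P) → p ≡ q
  torsion-irrelevant _ _ ∞ (_ , p) (_ , q) = cong (_ ,_) (uip p q)
  torsion-irrelevant _ _ (affine _ _) (p , p′) (q , q′) = cong₂ _,_ (uip p q) (uip p′ q′)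

  torsion-≡ : ∀ E n {P Q : Σ Point (Torsion E n)} → proj₁ P ≡ proj₁ Q → P ≡ Q
  torsion-≡ E n {P , p} {Q , q} refl = cong (P ,_) (torsion-irrelevant E n P p q)

  admissible⇒cyclic : ∀ {a b} → IsAdmissible a b → HasCyclic3Torsion (E₃ a b)
  admissible⇒cyclic {a} {b} adm =
    (λ Δ≡0 → *-≢0 (^-≢0 3 b≢0) (¬cube⇒≢0 adm) (trans (sym (Δ-E₃ a b)) Δ≡0)) ,
    (O , origin-torsion b≢0 , multiple) ,
    mk↔ₛ′ to from to-from from-to
    where
    b≢0 = admissible⇒≢0 adm
    O = affine 0# 0#
    open ≡-Reasoning

    -- The tangent at O is the line y = 0.
    2O≡-O : _⊕_ (E₃ a b) O O ≡ affine 0# (- b)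
    2O≡-O = trans (⊕-double (E₃ a b) ¬opposite) (cong₂ affine x′≡0 (linear-combination (λ′ ∷ a ∷ b ∷ x′ ∷ [])
      (λ λ′ a b x′ → :- (λ′ :* (x′ :- :0) :+ :0) :- a :* x′ :- b := :- b by (:- (λ′ :+ a) , x′ := :0) ∷ []) refl
      (x′≡0 , _)))
      where
      λ′ = tangent (E₃ a b) 0# 0#
      λ′≡0 : λ′ ≡ 0#
      λ′≡0 = linear-combination (a ∷ b ∷ (2 · 0# + a * 0# + b) ⁻¹ ∷ [])
        (λ a b i → (3 :· :0 :^ 2 :+ 2 :· :0 :* :0 :+ :0 :- a :* :0) :* i := :0 by []) refl _
      x′ = λ′ ^ 2 + a * λ′ - 0# - 0# - 0#
      x′≡0 : x′ ≡ 0#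
      x′≡0 = linear-combination (λ′ ∷ a ∷ [])
        (λ λ′ a → λ′ :^ 2 :+ a :* λ′ :- :0 :- :0 :- :0 := :0 by (λ′ :+ a , λ′ := :0) ∷ []) refl (λ′≡0 , _)
      ¬opposite : 0# + 0# + a * 0# + b ≢ 0#
      ¬opposite eq = b≢0 (linear-combination (a ∷ b ∷ [])
        (λ a b → b := :0 by (:1 , :0 :+ :0 :+ a :* :0 :+ b := :0) ∷ []) refl (eq , _))

    multiple : ∀ Q → Torsion (E₃ a b) 3 Q → ∃[ k ] Q ≡ _
    multiple Q tor with admissible⇒torsion adm Q tor
    ... | inj₁ refl = 0 , refl
    ... | inj₂ (inj₁ refl) = 1 , refl
    ... | inj₂ (inj₂ refl) = 2 , sym 2O≡-O

    -- Among the three torsion points the ordinate alone separates `O` from `-O`.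
    code : Point → Fin 3
    code ∞ = 0F
    code (affine _ y) with y ≟ 0#
    ... | yes _ = 1F
    ... | no _  = 2F

    code-O : code O ≡ 1F
    code-O with 0# ≟ 0#
    ... | yes _  = refl
    ... | no 0≢0 = contradiction refl 0≢0

    code-−O : code (affine 0# (- b)) ≡ 2F
    code-−O with - b ≟ 0#
    ... | yes -b≡0 = contradiction (-x≡0⇒x≡0 -b≡0) b≢0
    ... | no _     = refl

    to : Σ Point (Torsion (E₃ a b) 3) → Fin 3
    to (P , _) = code P

    from : Fin 3 → Σ Point (Torsion (E₃ a b) 3)
    from 0F = ∞ , _ , refl
    from 1F = O , origin-torsion b≢0
    from 2F = affine 0# (- b) , -origin-torsion b≢0

    to-from : ∀ i → to (from i) ≡ i
    to-from 0F = refl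
    to-from 1F = code-O
    to-from 2F = code-−O

    proj₁-from-code : ∀ P → Torsion (E₃ a b) 3 P → proj₁ (from (code P)) ≡ P
    proj₁-from-code P tor with admissible⇒torsion adm P tor
    ... | inj₁ refl        = refl
    ... | inj₂ (inj₁ refl) = cong (proj₁ ∘ from) code-O
    ... | inj₂ (inj₂ refl) = cong (proj₁ ∘ from) code-−O

    from-to : ∀ P → from (to P) ≡ P
    from-to (P , tor) = torsion-≡ (E₃ a b) 3 (proj₁-from-code P tor)

  -- The elements numbered `0F` and `1F` differ, so they cannot both be `∞`.
  nontrivial-torsion : ∀ E → Σ Point (Torsion E 3) ↔ Fin 3 → ∃[ x ] ∃[ y ] Torsion E 3 (affine x y)
  nontrivial-torsion E bij with Inverse.from bij 0F in eq₀ | Inverse.from bij 1F in eq₁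
  ... | affine x y , tor | _ = x , y , tor
  ... | ∞ , _ | affine x y , tor = x , y , tor
  ... | ∞ , p | ∞ , q = contradiction (begin
    0F                                    ≡⟨ Inverse.strictlyInverseˡ bij 0F ⟨
    Inverse.to bij (Inverse.from bij 0F)  ≡⟨ cong (Inverse.to bij) (trans eq₀ (trans (cong (∞ ,_) (torsion-irrelevant E 3 ∞ p q)) (sym eq₁))) ⟩
    Inverse.to bij (Inverse.from bij 1F)  ≡⟨ Inverse.strictlyInverseˡ bij 1F ⟩
    1F                                    ∎) λ ()
    where open ≡-Reasoning

  ρ²+ρ+1≡0 : ∀ {ρ} → IsPrimitiveCubeRootOfUnity ρ → ρ ^ 2 + ρ + 1# ≡ 0#
  ρ²+ρ+1≡0 {ρ} (ρ³≡1 , ρ≢1) = cancel {ρ - 1#} ρ-1≢0 (linear-combination (ρ ∷ [])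
    (λ ρ → (ρ :- :1) :* (ρ :^ 2 :+ ρ :+ :1) := :0 by (:1 , ρ :^ 3 := :1) ∷ []) refl (ρ³≡1 , _))
    where
    ρ-1≢0 : ρ - 1# ≢ 0#
    ρ-1≢0 eq = ρ≢1 (linear-combination (ρ ∷ []) (λ ρ → ρ := :1 by (:1 , ρ :- :1 := :0) ∷ []) refl (eq , _))

  module _ {ρ : Carrier} (3≢0 : 3 · 1# ≢ 0#) (prim : IsPrimitiveCubeRootOfUnity ρ) where

    -- This is the case `a = 3α`, `a³ - 27b = (3ε)³`. The flex of `second-flex` is a torsion point
    -- because the third coefficient of its model, `-εN(1 + 2ρ)`, is nonzero: `N` divides
    -- `b = (α - ε)N`.
    cube⇒four-torsion-points : ∀ {α ε b} → ε ≢ 0# → b ≢ 0# → b ≡ α ^ 3 - ε ^ 3 →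
      Σ (Fin 4 → Point) λ P → (∀ i → Torsion (E₃ (3 · α) b) 3 (P i)) × (∀ {i j} → P i ≡ P j → i ≡ j)
    cube⇒four-torsion-points {α} {ε} {b} ε≢0 b≢0 refl =
      P , P-torsion , λ {i} {j} Pi≡Pj → trans (sym (decode-P i)) (trans (cong decode Pi≡Pj) (decode-P j))
      where
      N = α ^ 2 + α * ε + ε ^ 2

      N≢0 : N ≢ 0#
      N≢0 N≡0 = b≢0 (linear-combination (α ∷ ε ∷ []) (λ α ε →
        α :^ 3 :- ε :^ 3 := :0 by (α :- ε , α :^ 2 :+ α :* ε :+ ε :^ 2 := :0) ∷ []) refl (N≡0 , _))

      -- `(1 + 2ρ)² = -3`.
      1+2ρ≢0 : 1# + 2 · ρ ≢ 0#
      1+2ρ≢0 eq = 3≢0 (linear-combination (ρ ∷ []) (λ ρ →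
        3 :· :1 := :0 by (4 :· :1 , ρ :^ 2 :+ ρ :+ :1 := :0) ∷ (:- (:1 :+ 2 :· ρ) , :1 :+ 2 :· ρ := :0) ∷ []) refl
        (ρ²+ρ+1≡0 prim , eq , _))

      P : Fin 4 → Point
      P 0F = ∞
      P 1F = affine 0# 0#
      P 2F = affine 0# (- b)
      P 3F = affine (- N) ((α - ρ * ε) * N)

      P-torsion : ∀ i → Torsion (E₃ (3 · α) b) 3 (P i)
      P-torsion 0F = _ , refl
      P-torsion 1F = origin-torsion b≢0
      P-torsion 2F = -origin-torsion b≢0
      P-torsion 3F = ≅E₃⇒torsion (second-flex α ε (ρ²+ρ+1≡0 prim)) (*-≢0 (*-≢0 ε≢0 N≢0) 1+2ρ≢0 ∘ -x≡0⇒x≡0)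

      -- A left inverse of `P`, which gives injectivity without comparing the points pairwise.
      decode : Point → Fin 4
      decode ∞ = 0F
      decode (affine x y) with x ≟ 0# | y ≟ 0#
      ... | no _  | _     = 3F
      ... | yes _ | yes _ = 1F
      ... | yes _ | no _  = 2F

      decode-P : ∀ i → decode (P i) ≡ i
      decode-P 0F = refl
      decode-P 1F with 0# ≟ 0#
      ... | yes _ = refl
      ... | no 0≢0 = contradiction refl 0≢0
      decode-P 2F with 0# ≟ 0# | - b ≟ 0#
      ... | no 0≢0 | _ = contradiction refl 0≢0
      ... | yes _ | yes -b≡0 = contradiction (-x≡0⇒x≡0 -b≡0) b≢0
      ... | yes _ | no _ = refl
      decode-P 3F with - N ≟ 0# | (α - ρ * ε) * N ≟ 0#
      ... | yes -N≡0 | _ = contradiction (-x≡0⇒x≡0 -N≡0) N≢0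
      ... | no _ | _ = refl

    -- A cube root `e` of `a³ - 27b` would yield, with `α = a/3` and `ε = e/3`, four torsion points
    -- on `E₃ a b`; transported to `E` they inject `Fin 4` into `Fin 3`.
    cyclic⇒≅E₃ : ∀ E → HasCyclic3Torsion E → ∃[ a ] ∃[ b ] IsAdmissible a b × E ≅ E₃ a b
    cyclic⇒≅E₃ E (elliptic , _ , bij)
      with x , y , tor ← nontrivial-torsion E bij
      with a , b , b≢0 , φ , _ ← torsion⇒≅E₃ E tor
      = a , b , adm , φ
      where
      adm : IsAdmissible a b
      adm (e , e³≡) = ℕ.<⇒≱ (ℕ.n<1+n 3) (injective⇒≤ {f = f} f-injective)
        where
        i = (3 · 1#) ⁻¹
        α = i * a
        ε = i * e
        3i≡1 = *-inverseʳ (3 · 1#) 3≢0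

        a≡3α : 3 · α ≡ a
        a≡3α = linear-combination (i ∷ a ∷ [])
          (λ i a → 3 :· (i :* a) := a by (a , (3 :· :1) :* i := :1) ∷ []) refl (3i≡1 , _)

        b≡α³-ε³ : b ≡ α ^ 3 - ε ^ 3
        b≡α³-ε³ = linear-combination (i ∷ a ∷ b ∷ e ∷ [])
          (λ i a b e →
            let w = (3 :· :1) :* i
            in
            b := (i :* a) :^ 3 :- (i :* e) :^ 3
            by (i :^ 3 , e :^ 3 := a :^ 3 :- 27 :· b)
             ∷ (:- (b :* (w :^ 2 :+ w :+ :1)) , w := :1) ∷ []) refl (e³≡ , 3i≡1 , _)

        -- This is where nonsingularity enters: `e = 0` means `a³ = 27b`, which makes the
        -- discriminant of `E` vanish.
        ε≢0 : ε ≢ 0#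
        ε≢0 ε≡0 = elliptic (cancel (^-≢0 12 (u≢0 (≅-sym φ))) (trans (Δ-≅E₃ (≅-sym φ)) (linear-combination
          (a ∷ b ∷ e ∷ [])
          (λ a b e → b :^ 3 :* (a :^ 3 :- 27 :· b) := :0
            by (:- (b :^ 3) , e :^ 3 := a :^ 3 :- 27 :· b) ∷ (b :^ 3 :* e :^ 2 , e := :0) ∷ []) refl
          (e³≡ , cancel (⁻¹-≢0 3≢0) ε≡0 , _))))

        φ′ : E ≅ E₃ (3 · α) b
        φ′ = subst (λ z → E ≅ E₃ z b) (sym a≡3α) φ

        four = cube⇒four-torsion-points ε≢0 b≢0 b≡α³-ε³
        P = proj₁ four

        E-torsion : Fin 4 → Σ Point (Torsion E 3)
        E-torsion k = transport φ′ (P k) , transport-torsion φ′ (P k) (proj₁ (proj₂ four) k)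

        f : Fin 4 → Fin 3
        f k = Inverse.to bij (E-torsion k)

        f-injective : ∀ {j k} → f j ≡ f k → j ≡ k
        f-injective {j} {k} eq = proj₂ (proj₂ four) (transport-injective φ′ {P j} {P k}
          (cong proj₁ (Injection.injective (↔⇒↣ bij) {E-torsion j} {E-torsion k} eq)))

-- Orbits of size three, pigeonhole, enumeration of subsets

private
  variable
    a b p : Level
    X : Set a
    Y : Set b

-- A number rather than a truth value, so that having exactly one least point per orbit becomes an
-- equation that can be summed.
least : ℕ → ℕ → ℕ → ℕ
least p q r with p ℕ.<? q | p ℕ.<? r
... | yes _ | yes _ = 1
... | _     | _     = 0

least-< : ∀ p q r → p ℕ.< q → p ℕ.< r → least p q r ≡ 1
least-< p q r p<q p<r with p ℕ.<? q | p ℕ.<? r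
... | yes _   | yes _   = refl
... | no p≮q  | _       = contradiction p<q p≮q
... | yes _   | no p≮r  = contradiction p<r p≮r

least-≮ˡ : ∀ p q r → q ℕ.< p → least p q r ≡ 0
least-≮ˡ p q r q<p with p ℕ.<? q | p ℕ.<? r
... | yes p<q | _ = contradiction p<q (ℕ.<⇒≯ q<p)
... | no _    | yes _ = refl
... | no _    | no _ = refl

least-≮ʳ : ∀ p q r → r ℕ.< p → least p q r ≡ 0
least-≮ʳ p q r r<p with p ℕ.<? q | p ℕ.<? r
... | _     | yes p<r = contradiction p<r (ℕ.<⇒≯ r<p)
... | yes _ | no _    = refl
... | no _  | no _    = refl

least-total : ∀ {p q r} → p ≢ q → q ≢ r → r ≢ p →
              least p q r ℕ.+ (least q r p ℕ.+ least r p q) ≡ 1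
least-total {p} {q} {r} p≢q q≢r r≢p with ℕ.<-cmp p q | ℕ.<-cmp q r | ℕ.<-cmp r p
... | tri≈ _ p≡q _ | _ | _ = contradiction p≡q p≢q
... | _ | tri≈ _ q≡r _ | _ = contradiction q≡r q≢r
... | _ | _ | tri≈ _ r≡p _ = contradiction r≡p r≢p
... | tri< p<q _ _ | _ | tri> _ _ p<r =
  cong₂ ℕ._+_ (least-< p q r p<q p<r) (cong₂ ℕ._+_ (least-≮ʳ q r p p<q) (least-≮ˡ r p q p<r))
... | tri> _ _ q<p | tri< q<r _ _ | _ =
  cong₂ ℕ._+_ (least-≮ˡ p q r q<p) (cong₂ ℕ._+_ (least-< q r p q<r q<p) (least-≮ʳ r p q q<r))
... | _ | tri> _ _ r<q | tri< r<p _ _ =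
  cong₂ ℕ._+_ (least-≮ʳ p q r r<p) (cong₂ ℕ._+_ (least-≮ˡ q r p r<q) (least-< r p q r<p r<q))
-- Comparisons that all point the same way around the cycle contradict transitivity.
... | tri< p<q _ _ | tri< q<r _ _ | tri< r<p _ _ = contradiction (ℕ.<-trans p<q (ℕ.<-trans q<r r<p)) (ℕ.<-irrefl refl)
... | tri> _ _ q<p | tri> _ _ r<q | tri> _ _ p<r = contradiction (ℕ.<-trans p<r (ℕ.<-trans r<q q<p)) (ℕ.<-irrefl refl)

-- The points that are least in their σ-orbit, and the two translates of this set
-- by σ, partition X.
free-order-3⇒3∣ : ∀ {n} → X ↔ Fin n → (σ : X → X) →
                  (∀ x → σ (σ (σ x)) ≡ x) → (∀ x → σ x ≢ x) → 3 ∣ n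
free-order-3⇒3∣ {X = X} {n} enum σ σ³≡id free = divides (sum h) (begin
  n                                                ≡⟨ ℕ.*-identityʳ n ⟨
  n ℕ.* 1                                          ≡⟨ ×≡* n 1 ⟨
  n ×₊ 1                                           ≡⟨ sum-replicate n ⟨
  sum {n} (λ _ → 1)                                ≡⟨ sum-cong-≗ partition ⟨
  sum (λ i → h i ℕ.+ (h (τ i) ℕ.+ h (τ (τ i))))    ≡⟨ ∑-distrib-+ h _ ⟩
  sum h ℕ.+ sum (λ i → h (τ i) ℕ.+ h (τ (τ i)))    ≡⟨ cong (sum h ℕ.+_) (∑-distrib-+ (h ∘ τ) (h ∘ τ ∘ τ)) ⟩
  sum h ℕ.+ (sum (h ∘ τ) ℕ.+ sum (h ∘ τ ∘ τ))      ≡⟨ cong (sum h ℕ.+_) (cong₂ ℕ._+_ (sum-permute h π)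
                                                        (trans (sum-permute h π) (sum-permute (h ∘ τ) π))) ⟨
  sum h ℕ.+ (sum h ℕ.+ sum h)                      ≡⟨ cong (λ k → sum h ℕ.+ (sum h ℕ.+ k)) (ℕ.+-identityʳ (sum h)) ⟨
  3 ℕ.* sum h                                      ≡⟨ ℕ.*-comm 3 (sum h) ⟩
  sum h ℕ.* 3                                      ∎)
  where
  open ≡-Reasoning
  open Sum ℕ.+-0-commutativeMonoid
  open Mult ℕ.+-0-monoid using () renaming (_×_ to _×₊_)
  open Inverse enum using (to; from; strictlyInverseˡ; strictlyInverseʳ)

  ×≡* : ∀ m k → m ×₊ k ≡ m ℕ.* k
  ×≡* zero k = refl
  ×≡* (suc m) k = cong (k ℕ.+_) (×≡* m k)

  τ : Fin n → Fin n
  τ i = to (σ (from i))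

  τ³≡id : ∀ i → τ (τ (τ i)) ≡ i
  τ³≡id i = begin
    to (σ (from (to (σ (from (to (σ (from i))))))))
      ≡⟨ cong (to ∘ σ) (strictlyInverseʳ _) ⟩
    to (σ (σ (from (to (σ (from i))))))
      ≡⟨ cong (to ∘ σ ∘ σ) (strictlyInverseʳ _) ⟩
    to (σ (σ (σ (from i))))
      ≡⟨ cong to (σ³≡id (from i)) ⟩
    to (from i)
      ≡⟨ strictlyInverseˡ i ⟩
    i ∎

  τ-free : ∀ i → toℕ i ≢ toℕ (τ i)
  τ-free i eq = free (from i) (begin
    σ (from i)              ≡⟨ strictlyInverseʳ _ ⟨
    from (τ i)              ≡⟨ cong from (Fin.toℕ-injective eq) ⟨
    from i                  ∎)

  π : Permutation n n
  π = mk↔ₛ′ τ (τ ∘ τ) τ³≡id τ³≡id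

  h : Fin n → ℕ
  h i = least (toℕ i) (toℕ (τ i)) (toℕ (τ (τ i)))

  partition : ∀ i → h i ℕ.+ (h (τ i) ℕ.+ h (τ (τ i))) ≡ 1
  partition i = orbit (cong toℕ (τ³≡id i)) (cong toℕ (τ³≡id (τ i)))
    where
    -- `l` and `m` abstract the third and fourth iterates of `τ`, which equal `i` and `τ i` only
    -- propositionally.
    orbit : ∀ {l m} → l ≡ toℕ i → m ≡ toℕ (τ i) →
            h i ℕ.+ (least (toℕ (τ i)) (toℕ (τ (τ i))) l ℕ.+ least (toℕ (τ (τ i))) l m) ≡ 1
    orbit refl refl = least-total (τ-free i) (τ-free (τ i))
      (subst (λ j → toℕ (τ (τ i)) ≢ toℕ j) (τ³≡id i) (τ-free (τ (τ i))))

lookup-unique : ∀ {xs : List X} → Unique xs → ∀ {i j} → lookup xs i ≡ lookup xs j → i ≡ j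
lookup-unique (x∉xs ∷ unique) {zero} {zero} eq = refl
lookup-unique (x∉xs ∷ unique) {zero} {suc j} eq = contradiction eq (All.lookup x∉xs (∈-lookup j))
lookup-unique (x∉xs ∷ unique) {suc i} {zero} eq = contradiction (sym eq) (All.lookup x∉xs (∈-lookup i))
lookup-unique (x∉xs ∷ unique) {suc i} {suc j} eq = cong suc (lookup-unique unique eq)

-- Punching out a missed value would inject `Fin (suc n)` into `Fin n`.
Fin-injective⇒surjective : ∀ {n} {f : Fin n → Fin n} → Injective _≡_ _≡_ f → ∀ y → ∃[ x ] f x ≡ y
Fin-injective⇒surjective {suc n} {f} inj y with Fin.any? (λ x → f x Fin.≟ y)
... | yes ∃x = ∃x
... | no ∄x = contradiction (injective⇒≤ (λ {i} {j} eq → inj (punchOut-injective (y≢f i) (y≢f j) eq))) ℕ.1+n≰n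
  where
  y≢f : ∀ i → y ≢ f i
  y≢f i y≡fi = ∄x (i , sym y≡fi)

∃? : ∀ {n} → X ↔ Fin n → {P : Pred X p} → Decidable P → Dec (∃ P)
∃? enum {P} P? =
  map′ (λ (i , Pi) → from i , Pi) (λ (x , Px) → to x , subst P (sym (strictlyInverseʳ x)) Px)
    (Fin.any? (P? ∘ from))
  where open Inverse enum using (to; from; strictlyInverseʳ)

-- Elements are counted without their proofs of `P`: a nonzero cube may have several cube roots, so
-- `Σ X P` could count it repeatedly.
record Listing {X : Set a} (P : Pred X p) : Set (a ⊔ p) where
  field
    size      : ℕ
    element   : Fin size → X
    injective : ∀ {i j} → element i ≡ element j → i ≡ j
    sound     : ∀ i → P (element i)
    complete  : ∀ {x} → P x → ∃[ i ] element i ≡ x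

listing : ∀ {n} → X ↔ Fin n → {P : Pred X p} → Decidable P → Listing P
listing {X = X} enum {P} P? = record
  { size = List.length xs
  ; element = lookup xs
  ; injective = lookup-unique (Unique.filter⁺ P? (Unique.tabulate⁺ (Injection.injective (↔⇒↣ (↔-sym enum)))))
  ; sound = λ i → proj₂ (∈-filter⁻ P? {xs = tabulate from} (∈-lookup i))
  ; complete = λ Px → index (∈xs Px) , sym (lookup-index (∈xs Px))
  }
  where
  open Inverse enum using (to; from; strictlyInverseʳ)
  xs : List X
  xs = filter P? (tabulate from)

  ∈xs : ∀ {x} → P x → x ∈ xs
  ∈xs {x} Px = ∈-filter⁺ P? (subst (_∈ tabulate from) (strictlyInverseʳ x) (∈-tabulate⁺ (to x))) Px

-- Invertibility of 3 and a primitive cube root of unity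

module FiniteFieldProperties {c : Level} (F : FiniteField c) where
  open FiniteField F
  open FieldProperties F
  open CommutativeRing commutativeRing using (+-commutativeMonoid)

  -- Translation by `1` permutes the field, so the sum `S` of all elements satisfies `S = S + q·1`.
  order·1≡0 : order · 1# ≡ 0#
  order·1≡0 = linear-combination (order · 1# ∷ sum from ∷ [])
    (λ n s → n := :0 by (:- :1 , s := s :+ n) ∷ []) refl (invariance , _)
    where
    open ≡-Reasoning
    open Sum +-commutativeMonoid
    open Inverse enumeration using (to; from; strictlyInverseˡ; strictlyInverseʳ)

    inverse : ∀ x y z → y ≡ - z → to (from (to (from x + y)) + z) ≡ x
    inverse x y z y≡-z = begin
      to (from (to (from x + y)) + z)  ≡⟨ cong (λ w → to (w + z)) (strictlyInverseʳ _) ⟩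
      to (from x + y + z)              ≡⟨ cong to (linear-combination (from x ∷ y ∷ z ∷ []) (λ x y z →
                                            x :+ y :+ z := x by (:1 , y := :- z) ∷ []) refl (y≡-z , _)) ⟩
      to (from x)                      ≡⟨ strictlyInverseˡ x ⟩
      x                                ∎

    π : Permutation order order
    π = mk↔ₛ′ (λ i → to (from i + 1#)) (λ i → to (from i + - 1#))
      (λ i → inverse i (- 1#) 1# refl)
      (λ i → inverse i 1# (- 1#) (linear-combination [] (:1 := :- :- :1 by []) refl _))

    invariance : sum from ≡ sum from + order · 1#
    invariance = begin
      sum from                              ≡⟨ sum-permute from π ⟩
      sum (from ∘ (π ⟨$⟩ʳ_))                ≡⟨ sum-cong-≗ (λ i → strictlyInverseʳ (from i + 1#)) ⟩
      sum (λ i → from i + 1#)               ≡⟨ ∑-distrib-+ from (λ _ → 1#) ⟩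
      sum from + sum {order} (λ _ → 1#)     ≡⟨ cong (sum from +_) (sum-replicate order) ⟩
      sum from + order · 1#                 ∎

  IsCube? : Decidable IsCube
  IsCube? x = ∃? enumeration (λ y → y ^ 3 ≟ x)

  module _ (order%3≡1 : order % 3 ≡ 1) where

    order≡ : order ≡ 1 ℕ.+ (order / 3) ℕ.* 3
    order≡ = trans (ℕ.m≡m%n+[m/n]*n order 3) (cong (ℕ._+ (order / 3) ℕ.* 3) order%3≡1)

    -- If `3 = 0`, then `q = 1 + 3k` gives `q·1 = 1`, while `q·1 = 0`.
    3≢0 : 3 · 1# ≢ 0#
    3≢0 3≡0 = 0≢1 (begin
      0#                                 ≡⟨ order·1≡0 ⟨
      order · 1#                         ≡⟨ cong (_· 1#) order≡ ⟩
      1# + (order / 3 ℕ.* 3) · 1#        ≡⟨ cong (1# +_) (×1-homo-* (order / 3) 3) ⟩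
      1# + (order / 3) · 1# * (3 · 1#)   ≡⟨ cong (λ z → 1# + (order / 3) · 1# * z) 3≡0 ⟩
      1# + (order / 3) · 1# * 0#         ≡⟨ linear-combination ((order / 3) · 1# ∷ []) (λ n → :1 :+ n :* :0 := :1 by []) refl _ ⟩
      1#                                 ∎)
      where
      open ≡-Reasoning
      open import Algebra.Properties.Semiring.Mult semiring using (×1-homo-*)

    -- The transformation x ↦ 1/(1 - x) of the projective line has order 3, and its
    -- fixed points are the -ρ with ρ a primitive cube root of unity. It has one,
    -- since the line has order + 1 ≡ 2 (mod 3) points.
    primitiveRoot : ∃ IsPrimitiveCubeRootOfUnity
    primitiveRoot = decidable-stable (∃? enumeration λ ρ → ρ ^ 3 ≟ 1# ×-dec ¬? (ρ ≟ 1#)) λ ∄ρ →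
      contradiction (free-order-3⇒3∣ line σ σ³≡id (free ∄ρ)) ¬3∣1+order
      where
      ¬3∣1+order : ¬ (3 ∣ suc order)
      ¬3∣1+order (divides k 1+order≡k*3) = contradiction (begin
        2                                     ≡⟨ ℕ.[m+kn]%n≡m%n 2 (order / 3) 3 ⟨
        (2 ℕ.+ order / 3 ℕ.* 3) % 3           ≡⟨ cong (λ m → suc m % 3) order≡ ⟨
        suc order % 3                       ≡⟨ cong (_% 3) 1+order≡k*3 ⟩
        (k ℕ.* 3) % 3                         ≡⟨ ℕ.m*n%n≡0 k 3 ⟩
        0                                     ∎) λ ()
        where open ≡-Reasoning

      line : Maybe Carrier ↔ Fin (suc order)
      line = mk↔ₛ′
        (λ { nothing → zero ; (just x) → suc (to x) })
        (λ { zero → nothing ; (suc i) → just (from i) })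
        (λ { zero → refl ; (suc i) → cong suc (strictlyInverseˡ i) })
        (λ { nothing → refl ; (just x) → cong just (strictlyInverseʳ x) })
        where open Inverse enumeration using (to; from; strictlyInverseˡ; strictlyInverseʳ)

      σ : Maybe Carrier → Maybe Carrier
      σ nothing = just 0#
      σ (just x) with x ≟ 1#
      ... | yes _ = nothing
      ... | no _  = just ((1# - x) ⁻¹)

      1-≢0 : ∀ {x} → x ≢ 1# → 1# - x ≢ 0#
      1-≢0 {x} x≢1 eq = x≢1 (linear-combination (x ∷ [])
        (λ x → x := :1 by (:- :1 , :1 :- x := :0) ∷ []) refl (eq , _))

      σ-1 : σ (just 1#) ≡ nothing
      σ-1 with 1# ≟ 1#
      ... | yes _ = refl
      ... | no 1≢1 = contradiction refl 1≢1

      σ-≢1 : ∀ {x y} → (1# - x) * y ≡ 1# → σ (just x) ≡ just y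
      σ-≢1 {x} {y} eq with x ≟ 1#
      ... | yes refl = contradiction (linear-combination (y ∷ [])
        (λ y → :0 := :1 by (:1 , (:1 :- :1) :* y := :1) ∷ []) refl (eq , _)) 0≢1
      ... | no x≢1 = cong just (*-cancelˡ (1-≢0 x≢1) (trans (*-inverseʳ _ (1-≢0 x≢1)) (sym eq)))

      σ-0 : σ (just 0#) ≡ just 1#
      σ-0 = σ-≢1 (linear-combination [] ((:1 :- :0) :* :1 := :1 by []) refl _)

      σ³≡id : ∀ x → σ (σ (σ x)) ≡ x
      σ³≡id nothing = trans (cong σ σ-0) σ-1
      σ³≡id (just x) = by-cases (x ≟ 0#) (x ≟ 1#)
        where
        by-cases : Dec (x ≡ 0#) → Dec (x ≡ 1#) → σ (σ (σ (just x))) ≡ just x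
        by-cases (yes refl) _ = trans (cong (σ ∘ σ) σ-0) (cong σ σ-1)
        by-cases (no _) (yes refl) = trans (cong (σ ∘ σ) σ-1) σ-0
        -- Away from the orbit of `0`, `1` and infinity the iterates are `x`, `1/(1 - x)`,
        -- `1 - 1/x`, `x`.
        by-cases (no x≢0) (no x≢1) = begin
          σ (σ (σ (just x)))           ≡⟨ cong (σ ∘ σ) (σ-≢1 [1-x]i≡1) ⟩
          σ (σ (just i))               ≡⟨ cong σ (σ-≢1 (linear-combination (x ∷ i ∷ k ∷ [])
                                            (λ x i k → (:1 :- i) :* (:1 :- k) := :1
                                              by (k , (:1 :- x) :* i := :1) ∷ (i , x :* k := :1) ∷ []) refl
                                            ([1-x]i≡1 , xk≡1 , _))) ⟩
          σ (just (1# - k))            ≡⟨ σ-≢1 (linear-combination (x ∷ k ∷ [])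
                                            (λ x k → (:1 :- (:1 :- k)) :* x := :1 by (:1 , x :* k := :1) ∷ []) refl
                                            (xk≡1 , _)) ⟩
          just x                       ∎
          where
          open ≡-Reasoning
          i = (1# - x) ⁻¹
          k = x ⁻¹
          [1-x]i≡1 = *-inverseʳ (1# - x) (1-≢0 x≢1)
          xk≡1 = *-inverseʳ x x≢0

      free : ¬ ∃ IsPrimitiveCubeRootOfUnity → ∀ x → σ x ≢ x
      free ∄ρ nothing ()
      free ∄ρ (just x) σx≡x with x ≟ 1#
      free ∄ρ (just x) () | yes _
      ... | no x≢1 = ∄ρ (- x ,
        linear-combination (x ∷ [])
          (λ x → (:- x) :^ 3 := :1 by (x :+ :1 , (:1 :- x) :* x := :1) ∷ []) refl ([1-x]x≡1 , _) ,
        -- At `x = -1` the relation `(1 - x)x = 1` reads `-2 = 1`.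
        λ -x≡1 → 3≢0 (linear-combination (x ∷ [])
          (λ x → 3 :· :1 := :0 by (:- :1 , (:1 :- x) :* x := :1) ∷ (x :- 2 :· :1 , :- x := :1) ∷ []) refl
          ([1-x]x≡1 , -x≡1 , _)))
        where
        [1-x]x≡1 : (1# - x) * x ≡ 1#
        [1-x]x≡1 = trans (cong ((1# - x) *_) (sym (just-injective σx≡x))) (*-inverseʳ _ (1-≢0 x≢1))

bijective⇒≡ : ∀ {m n} → X ↔ Fin m → Y ↔ Fin n → {f : X → Y} →
              (∀ {x y} → f x ≡ f y → x ≡ y) → (∀ y → ∃[ x ] f x ≡ y) → m ≡ n
bijective⇒≡ X↔ Y↔ inj surj =
  ↔⇒≡ (Y↔ ↔-∘ (⤖⇒↔ (mk⤖ (inj , λ y → proj₁ (surj y) , λ { refl → proj₂ (surj y) })) ↔-∘ ↔-sym X↔))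

injective⇒surjective : ∀ {n} → X ↔ Fin n → Y ↔ Fin n → {f : X → Y} →
                       (∀ {x y} → f x ≡ f y → x ≡ y) → ∀ y → ∃[ x ] f x ≡ y
injective⇒surjective X↔ Y↔ {f} inj y =
  let i , eq = Fin-injective⇒surjective {f = Inverse.to Y↔ ∘ f ∘ Inverse.from X↔}
                 (λ eq → Injection.injective (↔⇒↣ (↔-sym X↔)) (inj (Injection.injective (↔⇒↣ Y↔) eq)))
                 (Inverse.to Y↔ y)
  in Inverse.from X↔ i , Injection.injective (↔⇒↣ Y↔) eq

-- Cosets of the nonzero cubes and their sizes

module Cubes {c : Level} (F : FiniteField c) where
  open FiniteField F
  open FieldProperties F
  open FiniteFieldProperties F
  open Classification F using (quotient-cube; ρ²+ρ+1≡0; ¬cube⇒≢0)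

  -- Every coincidence makes `b` a cube: `y³ = bz³` gives `b = (y/z)³`, exponents 1 and 2 reduce to
  -- this on dividing by `b`, and `y³ = b²z³` gives `b = (bz/y)³`.
  coset-unique : ∀ {b y z} → ¬ IsCube b → y ≢ 0# → z ≢ 0# → ∀ (i j : Fin 3) →
                 b ^ toℕ i * y ^ 3 ≡ b ^ toℕ j * z ^ 3 → i ≡ j
  coset-unique {b} ¬cube = go
    where
    adjacent : ∀ {y z} → z ≢ 0# → b ^ 0 * y ^ 3 ≢ b ^ 1 * z ^ 3
    adjacent {y} {z} z≢0 eq = ¬cube (quotient-cube z≢0 (linear-combination (b ∷ y ∷ z ∷ [])
      (λ b y z → y :^ 3 := b :* z :^ 3 by (:1 , b :^ 0 :* y :^ 3 := b :^ 1 :* z :^ 3) ∷ []) refl (eq , _)))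

    adjacent′ : ∀ {y z} → z ≢ 0# → b ^ 1 * y ^ 3 ≢ b ^ 2 * z ^ 3
    adjacent′ {y} {z} z≢0 eq = adjacent z≢0 (*-cancelˡ (¬cube⇒≢0 ¬cube) (linear-combination (b ∷ y ∷ z ∷ [])
      (λ b y z → b :* (b :^ 0 :* y :^ 3) := b :* (b :^ 1 :* z :^ 3)
        by (:1 , b :^ 1 :* y :^ 3 := b :^ 2 :* z :^ 3) ∷ []) refl (eq , _)))

    extreme : ∀ {y z} → y ≢ 0# → b ^ 0 * y ^ 3 ≢ b ^ 2 * z ^ 3
    extreme {y} {z} y≢0 eq = ¬cube (quotient-cube y≢0 (linear-combination (b ∷ y ∷ z ∷ [])
      (λ b y z → (b :* z) :^ 3 := b :* y :^ 3 by (:- b , b :^ 0 :* y :^ 3 := b :^ 2 :* z :^ 3) ∷ []) refl (eq , _)))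

    go : ∀ {y z} → y ≢ 0# → z ≢ 0# → ∀ (i j : Fin 3) → b ^ toℕ i * y ^ 3 ≡ b ^ toℕ j * z ^ 3 → i ≡ j
    go y≢0 z≢0 0F 0F eq = refl
    go y≢0 z≢0 0F 1F eq = contradiction eq (adjacent z≢0)
    go y≢0 z≢0 0F 2F eq = contradiction eq (extreme y≢0)
    go y≢0 z≢0 1F 0F eq = contradiction (sym eq) (adjacent y≢0)
    go y≢0 z≢0 1F 1F eq = refl
    go y≢0 z≢0 1F 2F eq = contradiction eq (adjacent′ z≢0)
    go y≢0 z≢0 2F 0F eq = contradiction (sym eq) (extreme z≢0)
    go y≢0 z≢0 2F 1F eq = contradiction (sym eq) (adjacent′ y≢0)
    go y≢0 z≢0 2F 2F eq = refl

  -- `x³ - y³ = (x - y)(ρx - y)(ρ²x - y)`.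
  root-unique : ∀ {ρ} → IsPrimitiveCubeRootOfUnity ρ → ∀ {x y} → x ^ 3 ≡ y ^ 3 → ∃[ i ] ρ ^ toℕ {3} i * x ≡ y
  root-unique {ρ} prim {x} {y} x³≡y³ with x ≟ y | ρ * x ≟ y
  ... | yes x≡y | _ = 0F , trans (*-identityˡ x) x≡y
  ... | no _ | yes ρx≡y = 1F , linear-combination (ρ ∷ x ∷ y ∷ [])
    (λ ρ x y → ρ :^ 1 :* x := y by (:1 , ρ :* x := y) ∷ []) refl (ρx≡y , _)
  ... | no x≢y | no ρx≢y = 2F , linear-combination (ρ ∷ x ∷ y ∷ [])
    (λ ρ x y → ρ :^ 2 :* x := y by (:1 , ρ :^ 2 :* x :- y := :0) ∷ []) refl
    (cancel (-≢0 ρx≢y) (cancel (-≢0 x≢y) (linear-combination (ρ ∷ x ∷ y ∷ [])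
      (λ ρ x y → (x :- y) :* ((ρ :* x :- y) :* (ρ :^ 2 :* x :- y)) := :0
        by (:1 , x :^ 3 := y :^ 3)
         ∷ ((x :- y) :* (ρ :- :1) :* x :^ 2 :- (x :- y) :* x :* y , ρ :^ 2 :+ ρ :+ :1 := :0) ∷ []) refl
      (x³≡y³ , ρ²+ρ+1≡0 prim , _))) , _)
    where
    -≢0 : ∀ {x y} → x ≢ y → x - y ≢ 0#
    -≢0 {x} {y} x≢y eq = x≢y (linear-combination (x ∷ y ∷ []) (λ x y → x := y by (:1 , x :- y := :0) ∷ []) refl (eq , _))

  IsNonzeroCube : Pred Carrier c
  IsNonzeroCube x = x ≢ 0# × IsCube x

  cubes : Listing IsNonzeroCube
  cubes = listing enumeration (λ x → ¬? (x ≟ 0#) ×-dec IsCube? x)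

  noncubes : Listing (¬_ ∘ IsCube)
  noncubes = listing enumeration (¬? ∘ IsCube?)

  open Listing

  root : Fin (size cubes) → Carrier
  root i = proj₁ (proj₂ (sound cubes i))

  root³ : ∀ i → root i ^ 3 ≡ element cubes i
  root³ i = proj₂ (proj₂ (sound cubes i))

  root≢0 : ∀ i → root i ≢ 0#
  root≢0 i eq = proj₁ (sound cubes i) (trans (sym (root³ i)) (trans (cong (_^ 3) eq) (zeroˡ _)))

  Σ1+3n : ∀ n → (Fin 1 ⊎ Fin 3 × Fin n) ↔ Fin (1 ℕ.+ 3 ℕ.* n)
  Σ1+3n n = ↔-sym +↔⊎ ↔-∘ (↔-refl ⊎-↔ ↔-sym *↔×)

  module _ {ρ : Carrier} (prim : IsPrimitiveCubeRootOfUnity ρ) where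

    -- Each nonzero element is, in a unique way, a power of `ρ` times the chosen root of its cube.
    order≡1+3*cubes : order ≡ 1 ℕ.+ 3 ℕ.* size cubes
    order≡1+3*cubes = sym (bijective⇒≡ (Σ1+3n (size cubes)) enumeration {f} (λ {x} {y} → f-injective x y) f-surjective)
      where
      ρ≢0 : ρ ≢ 0#
      ρ≢0 refl = 0≢1 (trans (sym (zeroˡ _)) (proj₁ prim))

      f : Fin 1 ⊎ Fin 3 × Fin (size cubes) → Carrier
      f (inj₁ _) = 0#
      f (inj₂ (i , j)) = ρ ^ toℕ i * root j

      f≢0 : ∀ i j → ρ ^ toℕ i * root j ≢ 0#
      f≢0 i j = *-≢0 (^-≢0 (toℕ i) ρ≢0) (root≢0 j)

      f³ : ∀ i j → f (inj₂ (i , j)) ^ 3 ≡ element cubes j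
      f³ i j = trans (lemma i) (root³ j)
        where
        lemma : ∀ i → (ρ ^ toℕ {3} i * root j) ^ 3 ≡ root j ^ 3
        lemma 0F = cong (_^ 3) (*-identityˡ _)
        lemma 1F = linear-combination (ρ ∷ root j ∷ []) (λ ρ x →
          (ρ :^ 1 :* x) :^ 3 := x :^ 3 by (x :^ 3 , ρ :^ 3 := :1) ∷ []) refl (proj₁ prim , _)
        lemma 2F = linear-combination (ρ ∷ root j ∷ []) (λ ρ x →
          (ρ :^ 2 :* x) :^ 3 := x :^ 3 by ((ρ :^ 3 :+ :1) :* x :^ 3 , ρ :^ 3 := :1) ∷ []) refl (proj₁ prim , _)

      ρ^-injective : ∀ i j → ρ ^ toℕ {3} i ≡ ρ ^ toℕ {3} j → i ≡ j
      ρ^-injective 0F 0F eq = refl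
      ρ^-injective 1F 1F eq = refl
      ρ^-injective 2F 2F eq = refl
      ρ^-injective 0F 1F eq = contradiction (trans (sym (*-identityʳ ρ)) (sym eq)) (proj₂ prim)
      ρ^-injective 1F 0F eq = contradiction (trans (sym (*-identityʳ ρ)) eq) (proj₂ prim)
      ρ^-injective 1F 2F eq = contradiction (trans (sym (*-identityʳ ρ)) (sym (*-cancelˡ ρ≢0 eq))) (proj₂ prim)
      ρ^-injective 2F 1F eq = contradiction (trans (sym (*-identityʳ ρ)) (*-cancelˡ ρ≢0 eq)) (proj₂ prim)
      ρ^-injective 0F 2F eq = contradiction (linear-combination (ρ ∷ [])
        (λ ρ → ρ := :1 by (:1 , ρ :^ 3 := :1) ∷ (ρ , :1 := ρ :^ 2) ∷ []) refl (proj₁ prim , eq , _)) (proj₂ prim)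
      ρ^-injective 2F 0F eq = contradiction (linear-combination (ρ ∷ [])
        (λ ρ → ρ := :1 by (:1 , ρ :^ 3 := :1) ∷ (:- ρ , ρ :^ 2 := :1) ∷ []) refl (proj₁ prim , eq , _)) (proj₂ prim)

      f-injective : ∀ x y → f x ≡ f y → x ≡ y
      f-injective (inj₁ 0F) (inj₁ 0F) eq = refl
      f-injective (inj₁ 0F) (inj₂ (i , j)) eq = contradiction (sym eq) (f≢0 i j)
      f-injective (inj₂ (i , j)) (inj₁ 0F) eq = contradiction eq (f≢0 i j)
      f-injective (inj₂ (i , j)) (inj₂ (k , l)) eq
        with refl ← injective cubes (trans (sym (f³ i j)) (trans (cong (_^ 3) eq) (f³ k l)))
        = cong (λ i → inj₂ (i , j)) (ρ^-injective i k (*-cancelˡ (root≢0 j) (trans (*-comm _ _) (trans eq (*-comm _ _)))))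

      f-surjective : ∀ y → ∃[ x ] f x ≡ y
      f-surjective y with y ≟ 0#
      ... | yes refl = inj₁ 0F , refl
      ... | no y≢0 =
        let j , eq = complete cubes (^-≢0 3 y≢0 , y , refl)
            i , eq′ = root-unique prim (trans (root³ j) eq)
        in inj₂ (i , j) , eq′

    order≡1+cubes+noncubes : order ≡ 1 ℕ.+ (size cubes ℕ.+ size noncubes)
    order≡1+cubes+noncubes = sym (bijective⇒≡
      (↔-sym +↔⊎ ↔-∘ (↔-refl ⊎-↔ ↔-sym +↔⊎)) enumeration {f} (λ {x} {y} → f-injective x y) f-surjective)
      where
      f : Fin 1 ⊎ (Fin (size cubes) ⊎ Fin (size noncubes)) → Carrier
      f (inj₁ _) = 0#
      f (inj₂ (inj₁ i)) = element cubes i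
      f (inj₂ (inj₂ i)) = element noncubes i

      f-injective : ∀ x y → f x ≡ f y → x ≡ y
      f-injective (inj₁ 0F) (inj₁ 0F) eq = refl
      f-injective (inj₁ 0F) (inj₂ (inj₁ i)) eq = contradiction (sym eq) (proj₁ (sound cubes i))
      f-injective (inj₁ 0F) (inj₂ (inj₂ i)) eq = contradiction (sym eq) (¬cube⇒≢0 (sound noncubes i))
      f-injective (inj₂ (inj₁ i)) (inj₁ 0F) eq = contradiction eq (proj₁ (sound cubes i))
      f-injective (inj₂ (inj₂ i)) (inj₁ 0F) eq = contradiction eq (¬cube⇒≢0 (sound noncubes i))
      f-injective (inj₂ (inj₁ i)) (inj₂ (inj₁ j)) eq = cong (inj₂ ∘ inj₁) (injective cubes eq)
      f-injective (inj₂ (inj₂ i)) (inj₂ (inj₂ j)) eq = cong (inj₂ ∘ inj₂) (injective noncubes eq)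
      f-injective (inj₂ (inj₁ i)) (inj₂ (inj₂ j)) eq = contradiction (subst IsCube eq (proj₂ (sound cubes i))) (sound noncubes j)
      f-injective (inj₂ (inj₂ i)) (inj₂ (inj₁ j)) eq = contradiction (subst IsCube (sym eq) (proj₂ (sound cubes j))) (sound noncubes i)

      f-surjective : ∀ y → ∃[ x ] f x ≡ y
      f-surjective y with y ≟ 0# | IsCube? y
      ... | yes refl | _ = inj₁ 0F , refl
      ... | no y≢0 | yes cube = let i , eq = complete cubes (y≢0 , cube) in inj₂ (inj₁ i) , eq
      ... | no _ | no ¬cube = let i , eq = complete noncubes ¬cube in inj₂ (inj₂ i) , eq

    -- Zero together with the nonzero cubes multiplied by `1`, `b`, `b²` amounts to `1 + 3k`
    -- distinct elements, `k` being the number of nonzero cubes. This is the order of the field, so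
    -- nothing is missed.
    coset-exists : ∀ {b x} → ¬ IsCube b → x ≢ 0# → ∃[ i ] ∃[ v ] v ≢ 0# × b ^ toℕ {3} i * v ^ 3 ≡ x
    coset-exists {b} {x} ¬cube x≢0 =
      case injective⇒surjective (Σ1+3n (size cubes)) (subst (λ n → Carrier ↔ Fin n) order≡1+3*cubes enumeration)
             {f} (λ {x} {y} → f-injective x y) x of λ where
        (inj₁ _ , 0≡x) → contradiction (sym 0≡x) x≢0
        (inj₂ (i , j) , eq) → i , root j , root≢0 j , trans (cong (b ^ toℕ i *_) (root³ j)) eq
      where
      f : Fin 1 ⊎ Fin 3 × Fin (size cubes) → Carrier
      f (inj₁ _) = 0#
      f (inj₂ (i , j)) = b ^ toℕ i * element cubes j

      f≢0 : ∀ i j → b ^ toℕ {3} i * element cubes j ≢ 0#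
      f≢0 i j = *-≢0 (^-≢0 (toℕ i) (¬cube⇒≢0 ¬cube)) (proj₁ (sound cubes j))

      f-injective : ∀ x y → f x ≡ f y → x ≡ y
      f-injective (inj₁ 0F) (inj₁ 0F) eq = refl
      f-injective (inj₁ 0F) (inj₂ (i , j)) eq = contradiction (sym eq) (f≢0 i j)
      f-injective (inj₂ (i , j)) (inj₁ 0F) eq = contradiction eq (f≢0 i j)
      f-injective (inj₂ (i , j)) (inj₂ (k , l)) eq
        = cong₂ (λ i j → inj₂ (i , j)) i≡k (injective cubes (*-cancelˡ (^-≢0 (toℕ i) (¬cube⇒≢0 ¬cube))
            (trans eq (cong (λ i → b ^ toℕ i * element cubes l) (sym i≡k)))))
        where
        i≡k : i ≡ k
        i≡k = coset-unique ¬cube (root≢0 j) (root≢0 l) i k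
          (trans (cong (b ^ toℕ i *_) (root³ j)) (trans eq (cong (b ^ toℕ k *_) (sym (root³ l)))))

    noncubes≡2*cubes : size noncubes ≡ 2 ℕ.* size cubes
    noncubes≡2*cubes = ℕ.+-cancelˡ-≡ (1 ℕ.+ size cubes) _ _
      (trans (sym order≡1+cubes+noncubes) order≡1+3*cubes)

    [2*order+4]/3≡ : (2 ℕ.* order ℕ.+ 4) / 3 ≡ 2 ℕ.+ size noncubes
    [2*order+4]/3≡ = begin
      (2 ℕ.* order ℕ.+ 4) / 3                        ≡⟨ cong (λ q → (2 ℕ.* q ℕ.+ 4) / 3) order≡1+3*cubes ⟩
      (2 ℕ.* (1 ℕ.+ 3 ℕ.* size cubes) ℕ.+ 4) / 3     ≡⟨ cong (_/ 3) (rearrange (size cubes)) ⟩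
      (2 ℕ.+ 2 ℕ.* size cubes) ℕ.* 3 / 3             ≡⟨ ℕ.m*n/n≡m (2 ℕ.+ 2 ℕ.* size cubes) 3 ⟩
      2 ℕ.+ 2 ℕ.* size cubes                         ≡⟨ cong (2 ℕ.+_) noncubes≡2*cubes ⟨
      2 ℕ.+ size noncubes                            ∎
      where
      open ≡-Reasoning
      rearrange : ∀ n → 2 ℕ.* (1 ℕ.+ 3 ℕ.* n) ℕ.+ 4 ≡ (2 ℕ.+ 2 ℕ.* n) ℕ.* 3
      rearrange = solve-∀

    -- There are twice as many non-cubes as nonzero cubes, and `1` is a nonzero cube.
    noncube : ∃ (¬_ ∘ IsCube)
    noncube = element noncubes i , sound noncubes i
      where
      1-cube : IsNonzeroCube 1#
      1-cube = 1≢0 , 1# , linear-combination [] (:1 :^ 3 := :1 by []) refl _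

      i : Fin (size noncubes)
      i = subst Fin (sym noncubes≡2*cubes) (proj₁ (complete cubes 1-cube) Fin.↑ˡ _)

-- The family of representatives and the count of classes

module Representatives {c : Level} (F : FiniteField c) (order%3≡1 : FiniteField.order F % 3 ≡ 1) where
  open FiniteField F
  open FieldProperties F
  open FiniteFieldProperties F using (3≢0)
  open Curves F using (≅-trans; ≅-sym)
  open Torsion₃ F using (E₃)
  open Cyclic₃ F using (scaling)
  open Classification F
  open Cubes F
  open EllipticCurves F
  open Listing

  module _ {b₀ ρ : Carrier} (¬cube : ¬ IsCube b₀) (prim : IsPrimitiveCubeRootOfUnity ρ) where

    b₀≢0 : b₀ ≢ 0#
    b₀≢0 = ¬cube⇒≢0 ¬cube

    scaling⇒coset : ∀ {v} i j → v ≢ 0# → v ^ 3 * b₀ ^ toℕ {3} j ≡ b₀ ^ toℕ {3} i → i ≡ j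
    scaling⇒coset {v} i j v≢0 v³b₀ʲ≡b₀ⁱ = coset-unique {b₀} {1#} {v} ¬cube 1≢0 v≢0 i j
      (linear-combination (v ∷ b₀ ^ toℕ i ∷ b₀ ^ toℕ j ∷ [])
        (λ v β γ → β :* :1 :^ 3 := γ :* v :^ 3 by (:- :1 , v :^ 3 :* γ := β) ∷ []) refl (v³b₀ʲ≡b₀ⁱ , _))

    module _ {ℓ : Level} {_≤_ : Rel Carrier ℓ} (≤-isTotalOrder : IsTotalOrder _≡_ _≤_) where
      open Family b₀ ρ ≤-isTotalOrder
      open Min totalOrder using (_⊓_; ⊓-sel; ⊓-comm; ⊓-assoc)

      m-multiple : ∀ a → ∃[ i ] ρ ^ toℕ {3} i * a ≡ m a
      m-multiple a with ⊓-sel (a ⊓ (ρ * a)) (ρ ^ 2 * a) | ⊓-sel a (ρ * a)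
      ... | inj₂ ma≡ρ²a | _ = 2F , sym ma≡ρ²a
      ... | inj₁ ma≡ | inj₁ ≡a = 0F , trans (*-identityˡ a) (sym (trans ma≡ ≡a))
      ... | inj₁ ma≡ | inj₂ ≡ρa = 1F , trans (cong (_* a) (*-identityʳ ρ)) (sym (trans ma≡ ≡ρa))

      -- Multiplication by `ρ` permutes `a`, `ρa`, `ρ²a` cyclically, and a minimum ignores order.
      m-ρ* : ∀ a → m (ρ * a) ≡ m a
      m-ρ* a = begin
        ((ρ * a) ⊓ (ρ * (ρ * a))) ⊓ (ρ ^ 2 * (ρ * a))
          ≡⟨ cong₂ (λ x y → ((ρ * a) ⊓ x) ⊓ y)
               (linear-combination (ρ ∷ a ∷ []) (λ ρ a → ρ :* (ρ :* a) := ρ :^ 2 :* a by []) refl _)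
               (linear-combination (ρ ∷ a ∷ []) (λ ρ a → ρ :^ 2 :* (ρ :* a) := a by (a , ρ :^ 3 := :1) ∷ []) refl
                 (proj₁ prim , _)) ⟩
        ((ρ * a) ⊓ (ρ ^ 2 * a)) ⊓ a
          ≡⟨ ⊓-comm _ a ⟩
        a ⊓ ((ρ * a) ⊓ (ρ ^ 2 * a))
          ≡⟨ ⊓-assoc a (ρ * a) (ρ ^ 2 * a) ⟨
        m a ∎
        where open ≡-Reasoning

      m-ρ^* : ∀ n a → m (ρ ^ n * a) ≡ m a
      m-ρ^* zero a = cong m (*-identityˡ a)
      m-ρ^* (suc n) a = trans (cong m (*-assoc ρ (ρ ^ n) a)) (trans (m-ρ* (ρ ^ n * a)) (m-ρ^* n a))

      ρ^n³≡1 : ∀ n → (ρ ^ n) ^ 3 ≡ 1#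
      ρ^n³≡1 zero = linear-combination [] (:1 :^ 3 := :1 by []) refl _
      ρ^n³≡1 (suc n) = linear-combination (ρ ∷ ρ ^ n ∷ []) (λ ρ x →
        (ρ :* x) :^ 3 := :1 by (x :^ 3 , ρ :^ 3 := :1) ∷ (:1 , x :^ 3 := :1) ∷ []) refl (proj₁ prim , ρ^n³≡1 n , _)

      m³ : ∀ a → m a ^ 3 ≡ a ^ 3
      m³ a = let i , eq = m-multiple a in linear-combination (ρ ^ toℕ i ∷ a ∷ m a ∷ [])
        (λ x a ma → ma :^ 3 := a :^ 3
          by (:- (ma :^ 2 :+ ma :* (x :* a) :+ (x :* a) :^ 2) , x :* a := ma) ∷ (a :^ 3 , x :^ 3 := :1) ∷ []) refl
        (eq , ρ^n³≡1 (toℕ i) , _)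

      m-idem : ∀ a → m (m a) ≡ m a
      m-idem a = let i , eq = m-multiple a in trans (cong m (sym eq)) (m-ρ^* (toℕ i) a)

      -- Admissibility depends on `a` through `a³` only, which `m` preserves.
      m-admissible : ∀ i a → Admissible i a → IsAdmissible (m a) (b₀ ^ toℕ i)
      m-admissible i a = subst (λ z → ¬ IsCube (z - 27 · b₀ ^ toℕ i)) (sym (m³ a))

      E₃-represented : ∀ {a b v} i → IsAdmissible a b → v ≢ 0# → b₀ ^ toℕ {3} i * v ^ 3 ≡ b →
                       ∃[ a′ ] (Admissible i a′ × E₃ a b ≅ curve i a′)
      E₃-represented {a} {b} {v} i adm v≢0 b₀ⁱv³≡b = a′ , admissible , scaling w≢0 w*ma′≡a w³b₀ⁱ≡b
        where
        a′ = v ⁻¹ * a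
        vv⁻¹≡1 = *-inverseʳ v v≢0
        j = proj₁ (m-multiple a′)

        admissible : Admissible i a′
        admissible (d , d³≡) = adm (v * d , linear-combination (v ∷ v ⁻¹ ∷ a ∷ b ∷ d ∷ b₀ ^ toℕ i ∷ [])
          (λ v k a b d β → (v :* d) :^ 3 := a :^ 3 :- 27 :· b
            by (v :^ 3 , d :^ 3 := (k :* a) :^ 3 :- 27 :· β)
             ∷ (a :^ 3 :* ((v :* k) :^ 2 :+ v :* k :+ :1) , v :* k := :1)
             ∷ (:- (27 :· :1) , β :* v :^ 3 := b) ∷ []) refl
          (d³≡ , vv⁻¹≡1 , b₀ⁱv³≡b , _))

        x = ρ ^ toℕ j
        -- Since `x³ = 1`, the factor `x²` undoes the `x` in `m a′ = x a′`, and it leaves `w³ = v³`.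
        w = v * x ^ 2

        w≢0 : w ≢ 0#
        w≢0 = *-≢0 v≢0 (^-≢0 2 λ x≡0 → 0≢1 (trans (sym (zeroˡ _)) (trans (cong (_^ 3) (sym x≡0)) (ρ^n³≡1 (toℕ j)))))

        w*ma′≡a : w * m a′ ≡ a
        w*ma′≡a = linear-combination (v ∷ v ⁻¹ ∷ x ∷ a ∷ m a′ ∷ [])
          (λ v k x a ma′ → (v :* x :^ 2) :* ma′ := a
            by (:- (v :* x :^ 2) , x :* (k :* a) := ma′)
             ∷ (v :* k :* a , x :^ 3 := :1) ∷ (a , v :* k := :1) ∷ []) refl
          (proj₂ (m-multiple a′) , ρ^n³≡1 (toℕ j) , vv⁻¹≡1 , _)

        w³b₀ⁱ≡b : w ^ 3 * b₀ ^ toℕ i ≡ b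
        w³b₀ⁱ≡b = linear-combination (v ∷ x ∷ b ∷ b₀ ^ toℕ i ∷ [])
          (λ v x b β → (v :* x :^ 2) :^ 3 :* β := b
            by (:1 , β :* v :^ 3 := b) ∷ (v :^ 3 :* β :* (x :^ 3 :+ :1) , x :^ 3 := :1) ∷ []) refl
          (b₀ⁱv³≡b , ρ^n³≡1 (toℕ j) , _)

      represented : ∀ E → HasCyclic3Torsion E → ∃[ i ] ∃[ a ] (Admissible i a × E ≅ curve i a)
      represented E cyclic =
        let a , b , adm , φ = cyclic⇒≅E₃ (3≢0 order%3≡1) prim E cyclic
            i , v , v≢0 , b₀ⁱv³≡b = coset-exists prim ¬cube (admissible⇒≢0 adm)
            a′ , admissible , ψ = E₃-represented i adm v≢0 b₀ⁱv³≡b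
        in i , a′ , admissible , ≅-trans φ ψ

      unit-multiple⇒m≡ : ∀ {v a a′} → v ^ 3 ≡ 1# → v * m a′ ≡ m a → m a ≡ m a′
      unit-multiple⇒m≡ {v} {a} {a′} v³≡1 v*ma′≡ma =
        let k , ρᵏ≡v = root-unique prim {1#} {v} (linear-combination (v ∷ [])
              (λ v → :1 :^ 3 := v :^ 3 by (:- :1 , v :^ 3 := :1) ∷ []) refl (v³≡1 , _))
        in begin
          m a                       ≡⟨ m-idem a ⟨
          m (m a)                   ≡⟨ cong m v*ma′≡ma ⟨
          m (v * m a′)              ≡⟨ cong (λ z → m (z * m a′)) (trans (sym (*-identityʳ _)) ρᵏ≡v) ⟨
          m (ρ ^ toℕ k * m a′)      ≡⟨ m-ρ^* (toℕ k) (m a′) ⟩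
          m (m a′)                  ≡⟨ m-idem a′ ⟩
          m a′                      ∎
        where open ≡-Reasoning

      -- The isomorphism is a scaling by some `v`. Comparing cosets gives `i ≡ j`; then `v³ = 1`, so
      -- `v` is a power of `ρ` and `m` does not see it.
      distinct : ∀ i j a a′ → Admissible i a → Admissible j a′ → curve i a ≅ curve j a′ →
                 i ≡ j × m a ≡ m a′
      distinct i j a a′ adm _ φ =
        let v , v≢0 , v*ma′≡ma , v³b₀ʲ≡b₀ⁱ = ≅E₃⇒scaling (m-admissible i a adm) φ
            i≡j = scaling⇒coset i j v≢0 v³b₀ʲ≡b₀ⁱ
        in i≡j , unit-multiple⇒m≡ (v³≡1 v (trans (cong (λ k → v ^ 3 * b₀ ^ toℕ k) i≡j) v³b₀ʲ≡b₀ⁱ)) v*ma′≡ma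
        where
        v³≡1 : ∀ v → v ^ 3 * b₀ ^ toℕ i ≡ b₀ ^ toℕ i → v ^ 3 ≡ 1#
        v³≡1 v eq = *-cancelˡ (^-≢0 (toℕ i) b₀≢0) (trans (*-comm _ _) (trans eq (sym (*-identityʳ _))))

    ¬cube-power : ∀ i → i ≢ 0F → ¬ IsCube (b₀ ^ toℕ {3} i)
    ¬cube-power i i≢0 (d , d³≡b₀ⁱ) = i≢0 (sym (coset-unique {b₀} {d} {1#} ¬cube d≢0 1≢0 0F i
      (linear-combination (d ∷ b₀ ^ toℕ i ∷ [])
        (λ d β → :1 :* d :^ 3 := β :* :1 :^ 3 by (:1 , d :^ 3 := β) ∷ []) refl (d³≡b₀ⁱ , _))))
      where
      d≢0 : d ≢ 0#
      d≢0 refl = ^-≢0 (toℕ i) b₀≢0 (trans (sym d³≡b₀ⁱ) (zeroˡ _))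

    ⅓ : Carrier
    ⅓ = (3 · 1#) ⁻¹

    3*⅓≡1 : (3 · 1#) * ⅓ ≡ 1#
    3*⅓≡1 = *-inverseʳ _ (3≢0 order%3≡1)

    -- `-27b = (-3)³b` is a cube only if `b` is.
    admissible-0 : ∀ i → i ≢ 0F → IsAdmissible 0# (b₀ ^ toℕ {3} i)
    admissible-0 i i≢0 (d , d³≡) = ¬cube-power i i≢0 (- d * ⅓ , linear-combination (d ∷ ⅓ ∷ b₀ ^ toℕ i ∷ [])
      (λ d t β → (:- d :* t) :^ 3 := β
        by (:- (t :^ 3) , d :^ 3 := :0 :^ 3 :- 27 :· β)
         ∷ (β :* ((3 :· :1 :* t) :^ 2 :+ 3 :· :1 :* t :+ :1) , 3 :· :1 :* t := :1) ∷ []) refl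
      (d³≡ , 3*⅓≡1 , _))

    -- 1 - 27 (b-of w) = w.
    b-of : Carrier → Carrier
    b-of w = (1# - w) * ⅓ ^ 3

    admissible-1 : ∀ {w} → ¬ IsCube w → IsAdmissible 1# (b-of w)
    admissible-1 {w} ¬cube-w (d , d³≡) = ¬cube-w (d , linear-combination (w ∷ ⅓ ∷ d ∷ [])
      (λ w t d → d :^ 3 := w
        by (:1 , d :^ 3 := :1 :^ 3 :- 27 :· ((:1 :- w) :* t :^ 3))
         ∷ (:- ((:1 :- w) :* ((3 :· :1 :* t) :^ 2 :+ 3 :· :1 :* t :+ :1)) , 3 :· :1 :* t := :1) ∷ []) refl
      (d³≡ , 3*⅓≡1 , _))

    class : Fin (2 ℕ.+ size noncubes) → CurveWithCyclic3Torsion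
    class 0F            = E₃ 0# (b₀ ^ 1) , admissible⇒cyclic (admissible-0 1F λ ())
    class 1F            = E₃ 0# (b₀ ^ 2) , admissible⇒cyclic (admissible-0 2F λ ())
    class (suc (suc k)) = E₃ 1# (b-of (element noncubes k)) , admissible⇒cyclic (admissible-1 (sound noncubes k))

    E₃-0-injective : ∀ i j → i ≢ 0F → E₃ 0# (b₀ ^ toℕ {3} i) ≅ E₃ 0# (b₀ ^ toℕ {3} j) → i ≡ j
    E₃-0-injective i j i≢0 φ =
      let v , v≢0 , _ , eq = ≅E₃⇒scaling (admissible-0 i i≢0) φ in scaling⇒coset i j v≢0 eq

    E₃-1≇E₃-0 : ∀ {w b} → ¬ IsCube w → ¬ (E₃ 1# (b-of w) ≅ E₃ 0# b)
    E₃-1≇E₃-0 ¬cube-w φ with v , _ , v*0≡1 , _ ← ≅E₃⇒scaling (admissible-1 ¬cube-w) φ =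
      0≢1 (trans (sym (zeroʳ v)) v*0≡1)

    -- Equal first coefficients `1` force `v = 1`, so the third coefficients agree.
    E₃-1-injective : ∀ {w w′} → ¬ IsCube w → E₃ 1# (b-of w) ≅ E₃ 1# (b-of w′) → w ≡ w′
    E₃-1-injective {w} {w′} ¬cube-w φ with v , _ , v*1≡1 , eq ← ≅E₃⇒scaling (admissible-1 ¬cube-w) φ =
      *-cancelˡ (^-≢0 3 (⁻¹-≢0 (3≢0 order%3≡1))) (linear-combination (v ∷ w ∷ w′ ∷ ⅓ ∷ [])
        (λ v w w′ t → t :^ 3 :* w := t :^ 3 :* w′
          by (:1 , v :^ 3 :* ((:1 :- w′) :* t :^ 3) := (:1 :- w) :* t :^ 3)
           ∷ (:- ((:1 :- w′) :* t :^ 3 :* (v :^ 2 :+ v :+ :1)) , v :* :1 := :1) ∷ []) refl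
        (eq , v*1≡1 , _))

    class-injective : ∀ x y → class x ≅₃ class y → x ≡ y
    class-injective 0F 0F _ = refl
    class-injective 1F 1F _ = refl
    class-injective 0F 1F φ = contradiction (E₃-0-injective 1F 2F (λ ()) φ) λ ()
    class-injective 1F 0F φ = contradiction (E₃-0-injective 2F 1F (λ ()) φ) λ ()
    class-injective 0F (suc (suc k)) φ = contradiction (≅-sym φ) (E₃-1≇E₃-0 (sound noncubes k))
    class-injective 1F (suc (suc k)) φ = contradiction (≅-sym φ) (E₃-1≇E₃-0 (sound noncubes k))
    class-injective (suc (suc k)) 0F φ = contradiction φ (E₃-1≇E₃-0 (sound noncubes k))
    class-injective (suc (suc k)) 1F φ = contradiction φ (E₃-1≇E₃-0 (sound noncubes k))
    class-injective (suc (suc k)) (suc (suc l)) φ =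
      cong (λ i → suc (suc i)) (injective noncubes (E₃-1-injective (sound noncubes k) φ))

    admissible-0⇒scaling : ∀ {b} → IsAdmissible 0# b → ∃[ i ] i ≢ 0F × E₃ 0# b ≅ E₃ 0# (b₀ ^ toℕ {3} i)
    admissible-0⇒scaling {b} adm =
      let i , v , v≢0 , eq = coset-exists prim ¬cube (admissible⇒≢0 adm)
      in i , i≢0 i v eq , scaling v≢0 (zeroʳ v) (trans (*-comm _ _) eq)
      where
      i≢0 : ∀ i v → b₀ ^ toℕ {3} i * v ^ 3 ≡ b → i ≢ 0F
      i≢0 _ v eq refl = adm (- (3 · v) , linear-combination (v ∷ b ∷ [])
        (λ v b → (:- (3 :· v)) :^ 3 := :0 :^ 3 :- 27 :· b by (:- (27 :· :1) , :1 :* v :^ 3 := b) ∷ []) refl (eq , _))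

    -- Scaling by `a` leads to third coefficient `b/a³`, so `w = 1 - 27b/a³ = (a³ - 27b)/a³`, which
    -- is a cube only if `a³ - 27b` is.
    admissible-≢0⇒scaling : ∀ {a b} → a ≢ 0# → IsAdmissible a b → ∃[ w ] ¬ IsCube w × E₃ a b ≅ E₃ 1# (b-of w)
    admissible-≢0⇒scaling {a} {b} a≢0 adm = w , ¬cube-w , scaling a≢0 (*-identityʳ a) (linear-combination (a ∷ k ∷ b ∷ ⅓ ∷ [])
      (λ a k b t →
        let w = (a :^ 3 :- 27 :· b) :* k :^ 3
        in
        a :^ 3 :* ((:1 :- w) :* t :^ 3) := b
        by (:- ((a :^ 3 :- 27 :· b) :* a :^ 0 :* t :^ 3 :* ((a :* k) :^ 2 :+ a :* k :+ :1)) , a :* k := :1)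
         ∷ (b :* ((3 :· :1 :* t) :^ 2 :+ 3 :· :1 :* t :+ :1) , 3 :· :1 :* t := :1) ∷ []) refl
      (ak≡1 , 3*⅓≡1 , _))
      where
      k = a ⁻¹
      ak≡1 = *-inverseʳ a a≢0
      w = (a ^ 3 - 27 · b) * k ^ 3

      ¬cube-w : ¬ IsCube w
      ¬cube-w (d , d³≡w) = adm (a * d , linear-combination (a ∷ k ∷ b ∷ d ∷ [])
        (λ a k b d → (a :* d) :^ 3 := a :^ 3 :- 27 :· b
          by (a :^ 3 , d :^ 3 := (a :^ 3 :- 27 :· b) :* k :^ 3)
           ∷ ((a :^ 3 :- 27 :· b) :* ((a :* k) :^ 2 :+ a :* k :+ :1) , a :* k := :1) ∷ []) refl
        (d³≡w , ak≡1 , _))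

    E₃-surjective : ∀ a b → IsAdmissible a b → ∃[ x ] E₃ a b ≅ proj₁ (class x)
    E₃-surjective a b adm = by-cases (a ≟ 0#)
      where
      from-coset : ∀ i → i ≢ 0F → E₃ 0# b ≅ E₃ 0# (b₀ ^ toℕ {3} i) → ∃[ x ] E₃ 0# b ≅ proj₁ (class x)
      from-coset 0F i≢0 _ = contradiction refl i≢0
      from-coset 1F _ φ = 0F , φ
      from-coset 2F _ φ = 1F , φ

      by-cases : Dec (a ≡ 0#) → ∃[ x ] E₃ a b ≅ proj₁ (class x)
      by-cases (yes refl) = let i , i≢0 , φ = admissible-0⇒scaling adm in from-coset i i≢0 φ
      by-cases (no a≢0) =
        let w , ¬cube-w , φ = admissible-≢0⇒scaling a≢0 adm
            k , eq = complete noncubes ¬cube-w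
        in suc (suc k) , subst (λ w → E₃ a b ≅ E₃ 1# (b-of w)) (sym eq) φ

    class-surjective : ∀ E → HasCyclic3Torsion E → ∃[ x ] E ≅ proj₁ (class x)
    class-surjective E cyclic =
      let a , b , adm , φ = cyclic⇒≅E₃ (3≢0 order%3≡1) prim E cyclic
          x , ψ = E₃-surjective a b adm
      in x , ≅-trans φ ψ

    class-bijective : Bijective _≡_ _≅₃_ class
    class-bijective = (λ {x} {y} → class-injective x y) , λ (E , cyclic) →
      let x , φ = class-surjective E cyclic in x , λ { refl → ≅-sym φ }

  -- The count mentions neither `b₀` nor `ρ`, so both are first produced from `q ≡ 1 (mod 3)`.
  classes : ∃ λ (f : Fin ((2 ℕ.* order ℕ.+ 4) / 3) → CurveWithCyclic3Torsion) → Bijective _≡_ _≅₃_ f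
  classes =
    let ρ , prim = FiniteFieldProperties.primitiveRoot F order%3≡1
        b₀ , ¬cube = noncube prim
    in subst (λ n → ∃ λ (f : Fin n → CurveWithCyclic3Torsion) → Bijective _≡_ _≅₃_ f)
         (sym ([2*order+4]/3≡ prim)) (class ¬cube prim , class-bijective ¬cube prim)

proposition6 : ∀ {c ℓ} (F : FiniteField c) →
  let open FiniteField F
      open EllipticCurves F
  in
  order % 3 ≡ 1 →
  (∃ λ (f : Fin ((2 ℕ.* order ℕ.+ 4) / 3) → CurveWithCyclic3Torsion) → Bijective _≡_ _≅₃_ f)
  ×
  (∀ (b₀ ρ : Carrier) → ¬ IsCube b₀ → IsPrimitiveCubeRootOfUnity ρ →
   ∀ {_≤_ : Rel Carrier ℓ} (≤-isTotalOrder : IsTotalOrder _≡_ _≤_) →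
   let open Family b₀ ρ ≤-isTotalOrder
   in
   (∀ i a → Admissible i a → HasCyclic3Torsion (curve i a))
   ×
   (∀ E → HasCyclic3Torsion E → ∃[ i ] ∃[ a ] (Admissible i a × E ≅ curve i a))
   ×
   (∀ i j a a′ → Admissible i a → Admissible j a′ → curve i a ≅ curve j a′ →
      i ≡ j × m a ≡ m a′))
proposition6 F order%3≡1 = classes , λ b₀ ρ ¬cube prim ≤-isTotalOrder →
  (λ i a adm → admissible⇒cyclic (m-admissible ¬cube prim ≤-isTotalOrder i a adm)) ,
  represented ¬cube prim ≤-isTotalOrder ,
  distinct ¬cube prim ≤-isTotalOrder
  where
  open Classification F using (admissible⇒cyclic)
  open Representatives F order%3≡1
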